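{- Let $0\leq\varepsilon_c<\varepsilon_f\leq1$ and let $g=\varepsilon_f-\varepsilon_c$. There exists an $(\varepsilon_c,\varepsilon_f)$-IPP for Hamming-weight verification on inputs of length $n$, doubly sublinear in the regime $1/g^2=o(n)$, with $O(\log(1/g))$ rounds, verifier query complexity $O(\mathrm{polylog}(1/g^2)/g)$, honest-prover query complexity $O(1/g^2)$, and communication complexity $O(\mathrm{polylog}(1/g^2)/g+\log n)$.
   Context: For $x\in\{0,1\}^n$ let $\mathrm{wt}(x)=\frac1n\sum_i x_i$. Parties access $x$ through an oracle returning $x_i$ on query $i$; all parameters are known explicitly. An $(\varepsilon_c,\varepsilon_f)$-IPP for Hamming-weight verification consists of a probabilistic oracle verifier $V$ and a designated probabilistic honest prover $P_h$ (also having only oracle access to $x$) such that for every $n$, every $x\in\{0,1\}^n$ and every claimed absolute weight $\sigma\in\{0,\dots,n\}$: (completeness) if $|\mathrm{wt}(x)-\sigma/n|\leq\varepsilon_c$ then $V$ interacting with $P_h$ accepts with probability at least $2/3$; (soundness) if $|\mathrm{wt}(x)-\sigma/n|>\varepsilon_f$ then for every (computationally unbounded, possibly knowing $x$ entirely) prover $P^*$, $V$ accepts with probability at most $1/3$. Oracle queries of the verifier and of the designated honest prover are counted separately (those of the honest prover only on completeness instances); communication counts all bits sent in both directions. An IPP is doubly sublinear (a "dsIPP") in a parameter regime if both the verifier and the designated honest prover make $o(n)$ oracle queries in that regime. -}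

module Defs where

open import Data.Bool using (Bool; true; false; if_then_else_)
open import Data.Empty using (⊥)
open import Data.Fin using (Fin; toℕ)
open import Data.Integer as ℤ using (+_)
open import Data.List using (List; []; _∷_; length; map; sum)
open import Data.Nat as ℕ using (ℕ; zero; suc; NonZero)
open import Data.Nat.Solver using () renaming (module +-*-Solver to ℕ-Solver)
open import Data.Product using (Σ; ∃-syntax; _×_; _,_; uncurry)
open import Data.Rational using (ℚ; 0ℚ; 1ℚ; _/_; _+_; _-_; _*_; -_; ∣_∣; _≤_; _<_)
open import Data.Rational.Properties
import Data.Rational.Solver as ℚ-Solver
open import Data.Rational.Unnormalised as ℚᵘ using (mkℚᵘ; *≡*)
import Data.Rational.Unnormalised.Properties as ℚᵘ
open import Data.Unit using (⊤)
open import Data.Vec using (Vec; lookup; count)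
import Data.Vec.Functional as Vector
open import Algebra.Properties.Monoid.Sum +-0-monoid using () renaming (sum to sumℚ)
open import Relation.Binary.PropositionalEquality using (_≡_; refl; sym; cong; cong₂; subst₂)
open import Relation.Nullary.Decidable using (T?)

------------------------------------------------------------------------
-- Real numbers: Bishop's regular sequences of rationals.  The n-th term is
-- within 1/(n+1) of the number represented.

1/suc : ℕ → ℚ
1/suc n = + 1 / suc n

record ℝ : Set where
  field
    seq     : ℕ → ℚ
    regular : ∀ m n → ∣ seq m - seq n ∣ ≤ 1/suc m + 1/suc n
open ℝ public

private
  0≤1/suc : ∀ n → 0ℚ ≤ 1/suc n
  0≤1/suc n = nonNegative⁻¹ (1/suc n) {{normalize-nonNeg 1 (suc n)}}

  halves : ∀ m → 1/suc (suc (2 ℕ.* m)) + 1/suc (suc (2 ℕ.* m)) ≡ 1/suc m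
  halves m = toℚᵘ-injective (ℚᵘ.≃-trans (toℚᵘ-homo-+ h h)
    (ℚᵘ.≃-trans (ℚᵘ.+-cong h≃ h≃) (ℚᵘ.≃-trans eq (ℚᵘ.≃-sym (toℚᵘ-fromℚᵘ (mkℚᵘ (+ 1) m))))))
    where
    k = suc (2 ℕ.* m)
    h = 1/suc k
    h≃ = toℚᵘ-fromℚᵘ (mkℚᵘ (+ 1) k)
    open ℕ-Solver
    eqℕ : (1 ℕ.* suc k ℕ.+ 1 ℕ.* suc k) ℕ.* suc m ≡ 1 ℕ.* (suc k ℕ.* suc k)
    eqℕ = solve 1 (λ m → let s = con 2 :+ con 2 :* m in
      (con 1 :* s :+ con 1 :* s) :* (con 1 :+ m) := con 1 :* (s :* s)) refl m
    eq : mkℚᵘ (+ 1) k ℚᵘ.+ mkℚᵘ (+ 1) k ℚᵘ.≃ mkℚᵘ (+ 1) m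
    eq = *≡* (cong +_ eqℕ)

fromℚ : ℚ → ℝ
fromℚ q = record
  { seq     = λ _ → q
  ; regular = λ m n → subst₂ _≤_ (sym (cong ∣_∣ (+-inverseʳ q))) refl
                        (+-mono-≤ (0≤1/suc m) (0≤1/suc n))
  }

infixl 6 _-ℝ_
_-ℝ_ : ℝ → ℝ → ℝ
x -ℝ y = record { seq = λ n → seq x (d n) - seq y (d n) ; regular = reg }
  where
  d : ℕ → ℕ
  d n = suc (2 ℕ.* n)
  open ℚ-Solver.+-*-Solver
  reg : ∀ m n → ∣ (seq x (d m) - seq y (d m)) - (seq x (d n) - seq y (d n)) ∣
              ≤ 1/suc m + 1/suc n
  reg m n = begin
    ∣ (a - b) - (a′ - b′) ∣    ≡⟨ cong ∣_∣ (solve 4 (λ a b a′ b′ →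
                                    (a :- b) :- (a′ :- b′) := (a :- a′) :+ :- (b :- b′))
                                    refl a b a′ b′) ⟩
    ∣ (a - a′) + - (b - b′) ∣   ≤⟨ ∣p+q∣≤∣p∣+∣q∣ (a - a′) (- (b - b′)) ⟩
    ∣ a - a′ ∣ + ∣ - (b - b′) ∣ ≡⟨ cong (λ h → ∣ a - a′ ∣ + h) (∣-p∣≡∣p∣ (b - b′)) ⟩
    ∣ a - a′ ∣ + ∣ b - b′ ∣     ≤⟨ +-mono-≤ (regular x (d m) (d n)) (regular y (d m) (d n)) ⟩
    (r + s) + (r + s)          ≡⟨ solve 2 (λ r s → (r :+ s) :+ (r :+ s) := (r :+ r) :+ (s :+ s))
                                    refl r s ⟩
    (r + r) + (s + s)          ≡⟨ cong₂ _+_ (halves m) (halves n) ⟩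
    1/suc m + 1/suc n          ∎
    where
    open ≤-Reasoning
    a = seq x (d m)
    b = seq y (d m)
    a′ = seq x (d n)
    b′ = seq y (d n)
    r = 1/suc (d m)
    s = 1/suc (d n)

infix 4 _≤ℝ_ _<ℝ_ _⁻¹≤_

_≤ℝ_ : ℝ → ℝ → Set
x ≤ℝ y = ∀ n → - 1/suc n ≤ seq (y -ℝ x) n

_<ℝ_ : ℝ → ℝ → Set
x <ℝ y = ∃[ n ] 1/suc n < seq (y -ℝ x) n

-- g ⁻¹≤ t  says 1/g ≤ t, for g > 0.  For 0 < g ≤ 1 the least such t is
-- ⌈1/g⌉ < 2/g, so asymptotic bounds in 1/g are stated below as bounds in t
-- valid for every t with 1/g ≤ t.
_⁻¹≤_ : ℝ → ℕ → Set
g ⁻¹≤ zero  = ⊥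
g ⁻¹≤ suc d = fromℚ (1/suc d) ≤ℝ g

------------------------------------------------------------------------
-- Probabilistic computations with oracle access to an n-bit string.
-- `toss k` draws a uniformly random element of a (k+1)-element set.

data Comp (n : ℕ) (A : Set) : Set where
  return : A → Comp n A
  toss   : (k : ℕ) → (Fin (suc k) → Comp n A) → Comp n A
  query  : Fin n → (Bool → Comp n A) → Comp n A

𝔼 : ∀ {n} {A : Set} → Vec Bool n → Comp n A → (A → ℚ) → ℚ
𝔼 x (return a)  f = f a
𝔼 x (toss k c)  f = 1/suc k * sumℚ (λ i → 𝔼 x (c i) f)
𝔼 x (query i c) f = 𝔼 x (c (lookup x i)) f

-- Worst case over the coins of (w per oracle query) + (f of the result).
worst : ∀ {n} {A : Set} → ℕ → Vec Bool n → Comp n A → (A → ℕ) → ℕ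
worst w x (return a)  f = f a
worst w x (toss k c)  f = Vector.foldr ℕ._⊔_ 0 (λ i → worst w x (c i) f)
worst w x (query i c) f = w ℕ.+ worst w x (c (lookup x i)) f

------------------------------------------------------------------------
-- Interactive protocols.  The protocol prescribes, for each round, the number
-- of bits the verifier sends and the number of bits the prover replies.  Coins
-- and query answers of a party are private: they reach the other party only
-- through messages.

Shape : Set
Shape = List (ℕ × ℕ)

Verifier : ℕ → Shape → Set
Verifier n []            = Comp n Bool
Verifier n ((a , b) ∷ s) = Comp n (Vec Bool a × (Vec Bool b → Verifier n s))

Prover : ℕ → Shape → Set
Prover n []            = ⊤
Prover n ((a , b) ∷ s) = Vec Bool a → Comp n (Vec Bool b × Prover n s)

Pr[accept] : ∀ {n} s → Vec Bool n → Verifier n s → Prover n s → ℚ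
Pr[accept] []            x V P = 𝔼 x V (λ b → if b then 1ℚ else 0ℚ)
Pr[accept] ((a , b) ∷ s) x V P =
  𝔼 x V (λ (m , V′) → 𝔼 x (P m) (λ (r , P′) → Pr[accept] s x (V′ r) P′))

-- Worst case, over all coins, of v · (verifier queries) + p · (prover queries).
queryCost : ∀ {n} → (v p : ℕ) → ∀ s → Vec Bool n → Verifier n s → Prover n s → ℕ
queryCost v p []            x V P = worst v x V (λ _ → 0)
queryCost v p ((a , b) ∷ s) x V P =
  worst v x V (λ (m , V′) → worst p x (P m) (λ (r , P′) → queryCost v p s x (V′ r) P′))

verifierQueries proverQueries : ∀ {n} s → Vec Bool n → Verifier n s → Prover n s → ℕ
verifierQueries = queryCost 1 0
proverQueries   = queryCost 0 1

------------------------------------------------------------------------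
-- Hamming-weight verification

wt : ∀ {n} .{{_ : NonZero n}} → Vec Bool n → ℚ
wt {n} x = + count T? x / n

-- | wt(x) - σ/n |
deviation : ∀ {n} .{{_ : NonZero n}} → Vec Bool n → Fin (suc n) → ℚ
deviation {n} x σ = ∣ wt x - + toℕ σ / n ∣

-- Inputs have length n ≥ 1, since wt is undefined for n = 0.  A cheating prover
-- is quantified after x, so it may depend on x; the honest prover may not.
record IPP (εc εf : ℝ) : Set where
  field
    shape    : (n : ℕ) .{{_ : NonZero n}} → Shape
    verifier : (n : ℕ) .{{_ : NonZero n}} → Fin (suc n) → Verifier n (shape n)
    honest   : (n : ℕ) .{{_ : NonZero n}} → Fin (suc n) → Prover n (shape n)
    complete : ∀ n .{{_ : NonZero n}} (x : Vec Bool n) (σ : Fin (suc n)) →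
               fromℚ (deviation x σ) ≤ℝ εc →
               + 2 / 3 ≤ Pr[accept] (shape n) x (verifier n σ) (honest n σ)
    sound    : ∀ n .{{_ : NonZero n}} (x : Vec Bool n) (σ : Fin (suc n)) →
               εf <ℝ fromℚ (deviation x σ) →
               (P* : Prover n (shape n)) →
               Pr[accept] (shape n) x (verifier n σ) P* ≤ + 1 / 3

  rounds communication : (n : ℕ) .{{_ : NonZero n}} → ℕ
  rounds n        = length (shape n)
  communication n = sum (map (uncurry ℕ._+_) (shape n))

  -- The following two say that c · (query complexity on length n) ≤ b.
  VerifierQueries : (n : ℕ) .{{_ : NonZero n}} → (c b : ℕ) → Set
  VerifierQueries n c b = ∀ x σ (P* : Prover n (shape n)) →
    c ℕ.* verifierQueries (shape n) x (verifier n σ) P* ℕ.≤ b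

  HonestQueries : (n : ℕ) .{{_ : NonZero n}} → (c b : ℕ) → Set
  HonestQueries n c b = ∀ x σ → fromℚ (deviation x σ) ≤ℝ εc →
    c ℕ.* proverQueries (shape n) x (verifier n σ) (honest n σ) ℕ.≤ b

record Params : Set where
  field
    εc εf : ℝ
    0≤εc  : fromℚ 0ℚ ≤ℝ εc
    εc<εf : εc <ℝ εf
    εf≤1  : εf ≤ℝ fromℚ 1ℚ

  gap : ℝ
  gap = εf -ℝ εc

Family : Set
Family = (p : Params) → IPP (Params.εc p) (Params.εf p)

-- 1/g² = o(n) for parameters that may vary with n.
GapRegime : (ℕ → Params) → Set
GapRegime p = ∀ (c : ℕ) → ∃[ N ] ∀ n → N ℕ.≤ n →
  ∃[ t ] (Params.gap (p n) ⁻¹≤ t) × (c ℕ.* (t ℕ.* t) ℕ.≤ n)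

DoublySublinear : Family → Set
DoublySublinear Π = ∀ (p : ℕ → Params) → GapRegime p →
  ∀ (c : ℕ) → ∃[ N ] ∀ n .{{_ : NonZero n}} → N ℕ.≤ n →
    IPP.VerifierQueries (Π (p n)) n c n × IPP.HonestQueries (Π (p n)) n c n

{-# OPTIONS --safe #-}

module Submission where

-- Replace εc and εf by rationals cut and cut + 1/D with D = O(1/g).  The verifier
-- sends a seed of O(log n) + Õ(1/g) bits defining 4^h = O(D²) pairwise independent
-- sample points, so by Chebyshev the sampled weight is within 1/(4D) of wt x
-- except with small constant probability.  The honest prover reads the whole
-- sample and announces its weight, which the verifier compares with σ.  The
-- announcement is then verified exactly, by descending a binary tree over the
-- sample: the prover splits the claimed weight of a node between its two children
-- and the verifier moves to a random one.  A claim off by a fraction γ ends at a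
-- false leaf with probability at least γ, since the absolute errors at a level
-- sum to at least the error at the root; 10 D parallel paths therefore suffice,
-- and each of them costs the verifier one query.

open import Defs
open import Algebra.Bundles using (CommutativeRing)
open import Data.Bool using (Bool; true; false; T; if_then_else_)
open import Data.Fin as Fin using (Fin; zero; suc; toℕ; combine; remQuot)
open import Data.Fin.Permutation using (Permutation′; permutation)
import Data.Fin.Properties as Fin
open import Data.Integer as ℤ using (+[1+_]; -[1+_])
import Data.Integer.Properties as ℤ
open import Data.List using (List; []; _∷_; length; map; sum)
open import Data.Nat as ℕ using (zero; suc; z≤n; s≤s; _∸_; _%_; _!)
open import Data.Nat.DivMod using (_mod_; m≡m%n+[m/n]*n; [m+n]%n≡m%n; [m+kn]%n≡m%n; m%n%n≡m%n; m<n⇒m%n≡m; m%n<n)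
open import Data.Nat.Divisibility using (_∣_; divides; ∣-trans; m∣m*n; m≤n⇒m!∣n!)
open import Data.Nat.Logarithm using (⌈log₂_⌉; ⌈log₂⌉-mono-≤; ⌈log₂2^n⌉≡n; ⌈log₂2*n⌉≡1+⌈log₂n⌉)
import Data.Nat.Properties as ℕ
import Data.Nat.Tactic.RingSolver as ℕ-Ring
open import Data.Product using (Σ; ∃-syntax; _×_; _,_; proj₁; proj₂; uncurry)
open import Data.Sum using (_⊎_; inj₁; inj₂; [_,_]′)
open import Data.Unit using (tt)
open import Data.Vec using (Vec; []; _∷_; _++_; lookup; tabulate; count; take; drop)
open import Data.Vec.Properties using (∷-injectiveʳ; lookup∘tabulate; tabulate∘lookup; tabulate-cong; take++drop≡id)
import Data.Vec.Functional as Vector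
open import Function using (_∘_)
open import Level using (0ℓ)
open import Relation.Binary using (tri<; tri≈; tri>)
open import Relation.Binary.PropositionalEquality
open import Relation.Nullary using (Dec; yes; no; ¬_; contradiction)
open import Relation.Nullary.Decidable using (dec⇒maybe; from-yes; T?)
open import Tactic.RingSolver using (solve-∀)
open import Tactic.RingSolver.Core.AlmostCommutativeRing using (AlmostCommutativeRing; fromCommutativeRing)

-- Points `a + j b` are pairwise independent only if the differences of the indices `j` are
-- invertible modulo the sampling modulus. A modulus `m! n + 1` makes all positive numbers up to `m`
-- invertible with no search for a prime, but its residues have about `m log m + log n` bits.
-- Indexing all 4^h points along one line would force `m` to be about 4^h and a seed of order 1/g²
-- bits, beyond the allowed communication. On the grid `a + j b + k c` of side 2^h, `m = 2^h` is
-- enough, which is where the Õ(1/g) seed comes from.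
--
-- The sample need not be hidden from the prover: soundness uses only that the seed is uniform and
-- that directions are drawn after each reply. The parallel paths share their rounds, so a cheating
-- prover can correlate its replies across paths. This does not help it, because the bound on one
-- step holds for every fixed reply and the directions of different paths are independent.

module Verification where
  open import Data.Nat using (ℕ; NonZero; _^_)
  open import Data.Rational using (ℚ; mkℚ; 0ℚ; 1ℚ; ½; _/_; _+_; _-_; _*_; -_; ∣_∣; _≤_; _<_; nonNegative; positive)
  open import Data.Rational.Properties
  open import Data.Rational.Unnormalised as ℚᵘ using (mkℚᵘ; *≡*)
  import Data.Rational.Unnormalised.Properties as ℚᵘ
  import Algebra.Properties.Semiring.Sum (CommutativeRing.semiring +-*-commutativeRing) as Σℚ
  open import Algebra.Properties.Monoid.Sum +-0-monoid using (sum-cong-≗) renaming (sum to sumℚ)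

  -- Rational arithmetic

  ℚ-ring : AlmostCommutativeRing 0ℓ 0ℓ
  ℚ-ring = fromCommutativeRing +-*-commutativeRing (λ q → dec⇒maybe (0ℚ ≟ q))

  fromℕ : ℕ → ℚ
  fromℕ n = ℤ.+ n / 1

  fromℕ-+ : ∀ m n → fromℕ (m ℕ.+ n) ≡ fromℕ m + fromℕ n
  fromℕ-+ m n = toℚᵘ-injective (ℚᵘ.≃-trans (toℚᵘ-fromℚᵘ (mkℚᵘ (ℤ.+ (m ℕ.+ n)) 0))
    (ℚᵘ.≃-sym (ℚᵘ.≃-trans (toℚᵘ-homo-+ (fromℕ m) (fromℕ n))
      (ℚᵘ.≃-trans (ℚᵘ.+-cong (toℚᵘ-fromℚᵘ (mkℚᵘ (ℤ.+ m) 0)) (toℚᵘ-fromℚᵘ (mkℚᵘ (ℤ.+ n) 0)))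
        (*≡* (cong (ℤ._* ℤ.+ 1) (trans (cong₂ ℤ._+_ (ℤ.*-identityʳ (ℤ.+ m)) (ℤ.*-identityʳ (ℤ.+ n))) (sym (ℤ.pos-+ m n)))))))))

  /-* : ∀ a n b m → (ℤ.+ a / suc n) * (ℤ.+ b / suc m) ≡ ℤ.+ (a ℕ.* b) / (suc n ℕ.* suc m)
  /-* a n b m = toℚᵘ-injective (ℚᵘ.≃-trans (toℚᵘ-homo-* (ℤ.+ a / suc n) (ℤ.+ b / suc m))
    (ℚᵘ.≃-trans (ℚᵘ.*-cong (toℚᵘ-fromℚᵘ (mkℚᵘ (ℤ.+ a) n)) (toℚᵘ-fromℚᵘ (mkℚᵘ (ℤ.+ b) m)))
      (ℚᵘ.≃-trans (*≡* (cong (ℤ._* ℤ.+ (suc n ℕ.* suc m)) (sym (ℤ.pos-* a b))))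
        (ℚᵘ.≃-sym (toℚᵘ-fromℚᵘ (mkℚᵘ (ℤ.+ (a ℕ.* b)) (m ℕ.+ n ℕ.* suc m)))))))

  /-≡ : ∀ a n b m → a ℕ.* suc m ≡ b ℕ.* suc n → ℤ.+ a / suc n ≡ ℤ.+ b / suc m
  /-≡ a n b m e = fromℚᵘ-cong (*≡* {mkℚᵘ (ℤ.+ a) n} {mkℚᵘ (ℤ.+ b) m}
    (trans (sym (ℤ.pos-* a (suc m))) (trans (cong ℤ.+_ e) (ℤ.pos-* b (suc n)))))

  /-≤ : ∀ a n b m → a ℕ.* suc m ℕ.≤ b ℕ.* suc n → ℤ.+ a / suc n ≤ ℤ.+ b / suc m
  /-≤ a n b m e = toℚᵘ-cancel-≤ (ℚᵘ.≤-respˡ-≃ (ℚᵘ.≃-sym (toℚᵘ-fromℚᵘ (mkℚᵘ (ℤ.+ a) n)))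
    (ℚᵘ.≤-respʳ-≃ (ℚᵘ.≃-sym (toℚᵘ-fromℚᵘ (mkℚᵘ (ℤ.+ b) m)))
     (ℚᵘ.*≤* (subst₂ ℤ._≤_ (ℤ.pos-* a (suc m)) (ℤ.pos-* b (suc n)) (ℤ.+≤+ e)))))

  fromℕ-* : ∀ m n → fromℕ (m ℕ.* n) ≡ fromℕ m * fromℕ n
  fromℕ-* m n = sym (/-* m 0 n 0)

  fromℕ-mono : ∀ {m n} → m ℕ.≤ n → fromℕ m ≤ fromℕ n
  fromℕ-mono {m} {n} m≤n = /-≤ m 0 n 0 (ℕ.*-monoˡ-≤ 1 m≤n)

  fromℕ-cancel : ∀ {m n} → fromℕ m ≤ fromℕ n → m ℕ.≤ n
  fromℕ-cancel {m} {n} p with ℚᵘ.≤-respˡ-≃ (toℚᵘ-fromℚᵘ (mkℚᵘ (ℤ.+ m) 0)) (ℚᵘ.≤-respʳ-≃ (toℚᵘ-fromℚᵘ (mkℚᵘ (ℤ.+ n) 0)) (toℚᵘ-mono-≤ p))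
  ... | ℚᵘ.*≤* q = ℤ.drop‿+≤+ (subst₂ ℤ._≤_ (ℤ.*-identityʳ _) (ℤ.*-identityʳ _) q)

  0≤fromℕ : ∀ n → 0ℚ ≤ fromℕ n
  0≤fromℕ n = fromℕ-mono {0} {n} z≤n

  /-*-cancel : ∀ a n → (ℤ.+ a / suc n) * fromℕ (suc n) ≡ fromℕ a
  /-*-cancel a n = trans (/-* a n (suc n) 0) (/-≡ (a ℕ.* suc n) (n ℕ.* 1) a 0
    (trans (ℕ.*-assoc a (suc n) 1) refl))

  1/suc-* : ∀ n → 1/suc n * fromℕ (suc n) ≡ 1ℚ
  1/suc-* n = /-*-cancel 1 n

  0≤1/suc : ∀ n → 0ℚ ≤ 1/suc n
  0≤1/suc n = nonNegative⁻¹ (1/suc n) {{normalize-nonNeg 1 (suc n)}}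

  1/suc-antitone : ∀ {m n} → m ℕ.≤ n → 1/suc n ≤ 1/suc m
  1/suc-antitone {m} {n} m≤n = /-≤ 1 n 1 m (ℕ.*-monoʳ-≤ 1 (s≤s m≤n))

  *-monoˡ : ∀ {r p q} → 0ℚ ≤ r → p ≤ q → r * p ≤ r * q
  *-monoˡ {r} 0≤r = *-monoˡ-≤-nonNeg r {{nonNegative 0≤r}}

  *-monoʳ : ∀ {r p q} → 0ℚ ≤ r → p ≤ q → p * r ≤ q * r
  *-monoʳ {r} 0≤r = *-monoʳ-≤-nonNeg r {{nonNegative 0≤r}}

  *-mono : ∀ {p q r s} → 0ℚ ≤ r → 0ℚ ≤ q → p ≤ q → r ≤ s → p * r ≤ q * s
  *-mono 0≤r 0≤q p≤q r≤s = ≤-trans (*-monoʳ 0≤r p≤q) (*-monoˡ 0≤q r≤s)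

  0≤* : ∀ {p q} → 0ℚ ≤ p → 0ℚ ≤ q → 0ℚ ≤ p * q
  0≤* {p} {q} 0≤p 0≤q = subst (_≤ p * q) (*-zeroʳ p) (*-monoˡ 0≤p 0≤q)

  0≤+ : ∀ {p q} → 0ℚ ≤ p → 0ℚ ≤ q → 0ℚ ≤ p + q
  0≤+ = +-mono-≤

  p≤q⇒0≤q-p : ∀ {p q} → p ≤ q → 0ℚ ≤ q - p
  p≤q⇒0≤q-p {p} {q} p≤q = subst (_≤ q - p) (+-inverseʳ p) (+-monoˡ-≤ (- p) p≤q)

  0≤q-p⇒p≤q : ∀ {p q} → 0ℚ ≤ q - p → p ≤ q
  0≤q-p⇒p≤q {p} {q} 0≤ = subst₂ _≤_ (+-identityˡ p) (eq p q) (+-monoˡ-≤ p 0≤)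
    where
    eq : ∀ p q → (q - p) + p ≡ q
    eq = solve-∀ ℚ-ring

  -- The certificate form of linear arithmetic: the ring solver rewrites q - p as
  -- a sum of differences already known to be nonnegative.
  ≤-by : ∀ {p q r} → q - p ≡ r → 0ℚ ≤ r → p ≤ q
  ≤-by e 0≤r = 0≤q-p⇒p≤q (subst (0ℚ ≤_) (sym e) 0≤r)

  0≤sq : ∀ p → 0ℚ ≤ p * p
  0≤sq p with ≤-total 0ℚ p
  ... | inj₁ 0≤p = 0≤* 0≤p 0≤p
  ... | inj₂ p≤0 = subst (0ℚ ≤_) (eq p) (0≤* 0≤-p 0≤-p)
    where
    eq : ∀ p → - p * - p ≡ p * p
    eq = solve-∀ ℚ-ring
    0≤-p : 0ℚ ≤ - p
    0≤-p = neg-antimono-≤ p≤0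

  p≤∣p∣ : ∀ p → p ≤ ∣ p ∣
  p≤∣p∣ p with ≤-total 0ℚ p
  ... | inj₁ 0≤p = ≤-reflexive (sym (0≤p⇒∣p∣≡p 0≤p))
  ... | inj₂ p≤0 = ≤-trans p≤0 (0≤∣p∣ p)

  -p≤∣p∣ : ∀ p → - p ≤ ∣ p ∣
  -p≤∣p∣ p = subst (- p ≤_) (∣-p∣≡∣p∣ p) (p≤∣p∣ (- p))

  ∣p∣≤ : ∀ {p r} → p ≤ r → - p ≤ r → ∣ p ∣ ≤ r
  ∣p∣≤ {p} {r} h₁ h₂ with ∣p∣≡p∨∣p∣≡-p p
  ... | inj₁ e = subst (_≤ r) (sym e) h₁
  ... | inj₂ e = subst (_≤ r) (sym e) h₂

  ∣p-q∣≡∣q-p∣ : ∀ p q → ∣ p - q ∣ ≡ ∣ q - p ∣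
  ∣p-q∣≡∣q-p∣ p q = trans (cong ∣_∣ (eq p q)) (∣-p∣≡∣p∣ (q - p))
    where
    eq : ∀ p q → p - q ≡ - (q - p)
    eq = solve-∀ ℚ-ring

  ∣-∣-triangle : ∀ p q r → ∣ p - r ∣ ≤ ∣ p - q ∣ + ∣ q - r ∣
  ∣-∣-triangle p q r = subst (λ h → ∣ h ∣ ≤ ∣ p - q ∣ + ∣ q - r ∣)
    (eq p q r) (∣p+q∣≤∣p∣+∣q∣ (p - q) (q - r))
    where
    eq : ∀ p q r → (p - q) + (q - r) ≡ p - r
    eq = solve-∀ ℚ-ring

  -- Rational thresholds between two reals

  ∃-1/suc≤ : ∀ δ → 0ℚ < δ → ∃[ q ] 1/suc q ≤ δ
  ∃-1/suc≤ (mkℚ (ℤ.+ zero) q c) 0<δ with positive 0<δ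
  ... | ()
  ∃-1/suc≤ (mkℚ -[1+ _ ] q c) 0<δ with positive 0<δ
  ... | ()
  ∃-1/suc≤ δ@(mkℚ +[1+ p ] q c) 0<δ = q , subst (1/suc q ≤_) (↥p/↧p≡p δ)
    (/-≤ 1 q (suc p) q (ℕ.*-monoˡ-≤ (suc q) (s≤s (z≤n {p}))))

  -- Only failure at the immediate predecessor is recorded. This is enough for bounding `D`, and
  -- global minimality would be a stronger claim, as `Resolved` need not be monotone.
  descend : ∀ {P : ℕ → Set} → (∀ n → Dec (P n)) → ∀ N → P N →
            ∃[ n ] P n × (∀ m → n ≡ suc m → ¬ P m)
  descend P? zero    p = zero , p , λ _ ()
  descend P? (suc N) p with P? N
  ... | yes q = descend P? N q
  ... | no ¬q = suc N , p , λ { m refl → ¬q }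

  -- The verifier must decide its test, which it cannot do against a real; from here on it compares
  -- only with rationals. `below` and `above` transfer the hypotheses of completeness and soundness,
  -- and `bound` expresses that D = O(1/g).
  record Thresholds (p : Params) : Set where
    open Params p
    field
      D-1 : ℕ
      cut : ℚ
      below : ∀ q → fromℚ q ≤ℝ εc → q ≤ cut
      above : ∀ q → εf <ℝ fromℚ q → cut + 1/suc D-1 ≤ q
      bound : ∀ t → gap ⁻¹≤ t → suc D-1 ℕ.≤ 7 ℕ.* t

  -- Two of the three units pay for the errors of the approximations to εc and εf,
  -- the third is left between the thresholds.
  Resolved : ℝ → ℕ → Set
  Resolved g n = 1/suc n + 1/suc n + 1/suc n ≤ seq g n

  thresholdsAt : ∀ p n → Resolved (Params.gap p) n → (∀ m → n ≡ suc m → ¬ Resolved (Params.gap p) m) → Thresholds p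
  thresholdsAt p n Pn ¬Pn = record { D-1 = n ; cut = A + r ; below = below ; above = above ; bound = bound }
    where
    open Params p
    g = seq gap
    r = 1/suc n
    -- Term `n` of a difference of reals is built from terms `2n+1` of its arguments, so the test at
    -- `n` and the hypothesis on εc speak about the same approximation `A`.
    K = suc (2 ℕ.* n)
    A = seq εc K
    d≥ : ∀ k → k ℕ.≤ suc (2 ℕ.* k)
    d≥ k = ℕ.m≤n⇒m≤1+n (ℕ.m≤m+n k (k ℕ.+ 0))
    below : ∀ q → fromℚ q ≤ℝ εc → q ≤ A + r
    below q h = below-lemma A r q (h n)
      where
      eq₁ : ∀ A r q → (A + r) - q ≡ (A - q) - (- r)
      eq₁ = solve-∀ ℚ-ring
      below-lemma : ∀ A r q → - r ≤ A - q → q ≤ A + r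
      below-lemma A r q h = ≤-by {q} {A + r} (eq₁ A r q) (p≤q⇒0≤q-p h)
    above : ∀ q → εf <ℝ fromℚ q → A + r + r ≤ q
    above q (k , h) = above-lemma A (seq εf K) (seq εf (suc (2 ℕ.* k))) r (1/suc k) (1/suc K) (1/suc (suc (2 ℕ.* k))) q
      Pn (regular εf K (suc (2 ℕ.* k))) (1/suc-antitone (d≥ n)) (1/suc-antitone (d≥ k)) (<⇒≤ h)
      where
      eq₂ : ∀ A Bn Bk r s u v q → q - (A + r + r) ≡
        ((Bn - A) - (r + r + r)) + (((u + v) - (Bn - Bk)) + ((r - u) + ((s - v) + ((q - Bk) - s))))
      eq₂ = solve-∀ ℚ-ring
      above-lemma : ∀ A Bn Bk r s u v q → r + r + r ≤ Bn - A → ∣ Bn - Bk ∣ ≤ u + v → u ≤ r → v ≤ s →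
                    s ≤ q - Bk → A + r + r ≤ q
      above-lemma A Bn Bk r s u v q h₁ h₂ h₃ h₄ h₅ = ≤-by (eq₂ A Bn Bk r s u v q)
        (0≤+ (p≤q⇒0≤q-p h₁) (0≤+ (p≤q⇒0≤q-p (≤-trans (p≤∣p∣ _) h₂))
        (0≤+ (p≤q⇒0≤q-p h₃) (0≤+ (p≤q⇒0≤q-p h₄) (p≤q⇒0≤q-p h₅)))))
    bound : ∀ t → gap ⁻¹≤ t → suc n ℕ.≤ 7 ℕ.* t
    bound (suc e) h = go n ¬Pn
      where
      go : ∀ n → (∀ m → n ≡ suc m → ¬ Resolved gap m) → suc n ℕ.≤ 7 ℕ.* suc e
      go zero    _ = s≤s z≤n
      go (suc m) ¬P = ℕ.≤-trans (ℕ.≤-trans (ℕ.+-monoʳ-≤ 1 ineq) (ℕ.+-monoˡ-≤ (6 ℕ.* suc e) (s≤s (z≤n {e}))))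
                        (ℕ.≤-refl {7 ℕ.* suc e})
        where
        w = 1/suc e
        r′ = 1/suc m
        d = suc (2 ℕ.* m)
        eq₃ : ∀ w r v gm gd → fromℕ 6 * r - w ≡
          ((gd - w) - (- r)) + (((r + v) - (- (gm - gd))) + ((r - v) + ((r + r + r) - gm)))
        eq₃ = solve-∀ ℚ-ring
        eq₄ : ∀ c r e m → c * (r * e) * m ≡ c * e * (r * m)
        eq₄ = solve-∀ ℚ-ring
        -- Six units `r′`: one from the lower bound on the gap, two for passing from its term `2m+1`
        -- to its term `m`, three from the failed test at `m`. Hence m + 1 ≤ 6t, and the step from
        -- `m` back to `n` turns 6t into 7t.
        w≤6r′ : w ≤ fromℕ 6 * r′
        w≤6r′ = ≤-by
          (eq₃ w r′ (1/suc d) (g m) (g d))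
          (0≤+ (p≤q⇒0≤q-p (h m))
          (0≤+ (p≤q⇒0≤q-p (≤-trans (-p≤∣p∣ _) (regular gap m d)))
          (0≤+ (p≤q⇒0≤q-p (1/suc-antitone (d≥ m)))
               (p≤q⇒0≤q-p (<⇒≤ (≰⇒> (¬P m refl)))))))
        ineq : suc m ℕ.≤ 6 ℕ.* suc e
        ineq = fromℕ-cancel (subst₂ _≤_
          (trans (cong (_* fromℕ (suc m)) (1/suc-* e)) (*-identityˡ _))
          (trans (eq₄ (fromℕ 6) r′ (fromℕ (suc e)) (fromℕ (suc m)))
            (trans (cong (fromℕ 6 * fromℕ (suc e) *_) (1/suc-* m)) (trans (*-identityʳ _) (sym (fromℕ-* 6 (suc e))))))
          (*-monoʳ (0≤fromℕ (suc m)) (subst (w * fromℕ (suc e) ≤_) (*-assoc (fromℕ 6) r′ (fromℕ (suc e))) (*-monoʳ (0≤fromℕ (suc e)) w≤6r′))))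

  computeThresholds : (p : Params) → Thresholds p
  computeThresholds p = thresholdsAt p (proj₁ found) (proj₁ (proj₂ found)) (proj₂ (proj₂ found))
    where
    open Params p
    g = seq gap
    n₀ = proj₁ εc<εf
    s₀ = 1/suc n₀
    δ = g n₀ - s₀
    0<δ : 0ℚ < δ
    0<δ = subst (_< δ) (+-inverseʳ s₀) (+-monoˡ-< (- s₀) (proj₂ εc<εf))
    q₀ = proj₁ (∃-1/suc≤ δ 0<δ)
    -- Makes 4/(N+1) equal to 1/(q₀+1): three units for the test and one for moving from term `n₀`
    -- to term `N`. The other half of that regularity error is already subtracted in `δ`.
    N = 3 ℕ.+ 4 ℕ.* q₀
    R = 1/suc N
    4R : R + R + R + R ≡ 1/suc q₀
    4R = trans (r+r+r+r R) (trans (/-* 4 0 1 N) (/-≡ 4 (N ℕ.+ 0) 1 q₀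
      (4*[1+q] q₀)))
      where
      r+r+r+r : ∀ r → r + r + r + r ≡ fromℕ 4 * r
      r+r+r+r = solve-∀ ℚ-ring
      4*[1+q] : ∀ q → 4 ℕ.* suc q ≡ 1 ℕ.* suc (3 ℕ.+ 4 ℕ.* q ℕ.+ 0)
      4*[1+q] = ℕ-Ring.solve-∀
    eq : ∀ gN g₀ s r → gN - (r + r + r) ≡ ((s + r) - (g₀ - gN)) + ((g₀ - s) - (r + r + r + r))
    eq = solve-∀ ℚ-ring
    PN : Resolved gap N
    PN = ≤-by (eq (g N) (g n₀) s₀ R)
           (0≤+ (p≤q⇒0≤q-p (≤-trans (p≤∣p∣ _) (regular gap n₀ N)))
                (p≤q⇒0≤q-p (subst (_≤ δ) (sym 4R) (proj₂ (∃-1/suc≤ δ 0<δ)))))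
    found = descend {Resolved gap} (λ n → _ ≤? g n) N PN

  abstract
    thresholds : (p : Params) → Thresholds p
    thresholds = computeThresholds

  -- Expectations

  sum-mono : ∀ {n} {f g : Fin n → ℚ} → (∀ i → f i ≤ g i) → sumℚ f ≤ sumℚ g
  sum-mono {zero}  h = ≤-refl
  sum-mono {suc n} h = +-mono-≤ (h zero) (sum-mono (h ∘ suc))

  sum-const : ∀ n c → sumℚ {n} (λ _ → c) ≡ c * fromℕ n
  sum-const zero    c = sym (*-zeroʳ c)
  sum-const (suc n) c = trans (cong (c +_) (sum-const n c))
    (trans (eq c (fromℕ n)) (cong (c *_) (sym (fromℕ-+ 1 n))))
    where
    eq : ∀ c m → c + c * m ≡ c * (1ℚ + m)
    eq = solve-∀ ℚ-ring

  -- A positive, linear, normalised functional. This is all that Chebyshev's argument needs, and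
  -- nested averages over three tosses satisfy it without the construction of a product space.
  record IsExpectation {Ω : Set} (E : (Ω → ℚ) → ℚ) : Set where
    field
      mono   : ∀ {f g} → (∀ ω → f ω ≤ g ω) → E f ≤ E g
      +-homo : ∀ f g → E (λ ω → f ω + g ω) ≡ E f + E g
      *-homo : ∀ c f → E (λ ω → c * f ω) ≡ c * E f
      const  : ∀ c → E (λ _ → c) ≡ c

    ≗-cong : ∀ {f g} → (∀ ω → f ω ≡ g ω) → E f ≡ E g
    ≗-cong h = ≤-antisym (mono (≤-reflexive ∘ h)) (mono (≤-reflexive ∘ sym ∘ h))

  avg : ∀ k → (Fin (suc k) → ℚ) → ℚ
  avg k f = 1/suc k * sumℚ f

  avg-isExpectation : ∀ k → IsExpectation (avg k)
  avg-isExpectation k = record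
    { mono   = λ h → *-monoˡ (0≤1/suc k) (sum-mono h)
    ; +-homo = λ f g → trans (cong (1/suc k *_) (Σℚ.∑-distrib-+ f g)) (*-distribˡ-+ (1/suc k) (sumℚ f) (sumℚ g))
    ; *-homo = λ c f → trans (cong (1/suc k *_) (sym (Σℚ.*-distribˡ-sum c f))) (eq (1/suc k) c (sumℚ f))
    ; const  = λ c → trans (cong (1/suc k *_) (sum-const (suc k) c))
                       (trans (eq (1/suc k) c (fromℕ (suc k))) (trans (cong (c *_) (1/suc-* k)) (*-identityʳ c)))
    }
    where
    eq : ∀ r c s → r * (c * s) ≡ c * (r * s)
    eq = solve-∀ ℚ-ring

  ×-isExpectation : ∀ {Ω Ω′ : Set} {E : (Ω → ℚ) → ℚ} {E′ : (Ω′ → ℚ) → ℚ} →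
    IsExpectation E → IsExpectation E′ → IsExpectation {Ω × Ω′} (λ f → E (λ ω → E′ (λ ω′ → f (ω , ω′))))
  ×-isExpectation {E = E} e e′ = record
    { mono   = λ h → e.mono (λ ω → e′.mono (λ ω′ → h (ω , ω′)))
    ; +-homo = λ f g → trans (e.≗-cong (λ ω → e′.+-homo _ _)) (e.+-homo _ _)
    ; *-homo = λ c f → trans (e.≗-cong (λ ω → e′.*-homo c _)) (e.*-homo c _)
    ; const  = λ c → trans (e.≗-cong (λ _ → e′.const c)) (e.const c)
    }
    where
    module e = IsExpectation e
    module e′ = IsExpectation e′

  avg-swap : ∀ k l (f : Fin (suc k) → Fin (suc l) → ℚ) →
    avg k (λ i → avg l (f i)) ≡ avg l (λ j → avg k (λ i → f i j))
  avg-swap k l f = begin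
    u * sumℚ (λ i → v * sumℚ (f i))           ≡⟨ cong (u *_) (Σℚ.*-distribˡ-sum v (λ i → sumℚ (f i))) ⟨
    u * (v * sumℚ (λ i → sumℚ (f i)))         ≡⟨ cong (λ h → u * (v * h)) (Σℚ.∑-comm f) ⟩
    u * (v * sumℚ (λ j → sumℚ (λ i → f i j))) ≡⟨ eq u v _ ⟩
    v * (u * sumℚ (λ j → sumℚ (λ i → f i j))) ≡⟨ cong (v *_) (Σℚ.*-distribˡ-sum u (λ j → sumℚ (λ i → f i j))) ⟩
    v * sumℚ (λ j → u * sumℚ (λ i → f i j))   ∎
    where
    open ≡-Reasoning
    u = 1/suc k
    v = 1/suc l
    eq : ∀ r c s → r * (c * s) ≡ c * (r * s)
    eq = solve-∀ ℚ-ring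

  -- Second moments of sums over a binary cube

  Σᵇ : ∀ d → (Vec Bool d → ℚ) → ℚ
  Σᵇ zero    f = f []
  Σᵇ (suc d) f = Σᵇ d (f ∘ (false ∷_)) + Σᵇ d (f ∘ (true ∷_))

  module _ {Ω : Set} {E : (Ω → ℚ) → ℚ} (isE : IsExpectation E) where
    open IsExpectation isE

    private
      E-Σᵇʳ : ∀ d (f : Ω → ℚ) (G : Vec Bool d → Ω → ℚ) → (∀ w → E (λ ω → f ω * G w ω) ≡ 0ℚ) →
              E (λ ω → f ω * Σᵇ d (λ w → G w ω)) ≡ 0ℚ
      E-Σᵇʳ zero    f G h = h []
      E-Σᵇʳ (suc d) f G h = trans (≗-cong (λ ω → *-distribˡ-+ (f ω) (Σᵇ d (λ w → G (false ∷ w) ω)) (Σᵇ d (λ w → G (true ∷ w) ω)))) (trans (+-homo _ _)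
        (cong₂ _+_ (E-Σᵇʳ d f (G ∘ (false ∷_)) (h ∘ (false ∷_))) (E-Σᵇʳ d f (G ∘ (true ∷_)) (h ∘ (true ∷_)))))

    uncorrelated-Σᵇ : ∀ d e (F : Vec Bool d → Ω → ℚ) (G : Vec Bool e → Ω → ℚ) →
      (∀ v w → E (λ ω → F v ω * G w ω) ≡ 0ℚ) → E (λ ω → Σᵇ d (λ v → F v ω) * Σᵇ e (λ w → G w ω)) ≡ 0ℚ
    uncorrelated-Σᵇ zero    e F G h = E-Σᵇʳ e (F []) G (h [])
    uncorrelated-Σᵇ (suc d) e F G h = trans (≗-cong (λ ω → *-distribʳ-+ (Σᵇ e (λ w → G w ω)) (Σᵇ d (λ v → F (false ∷ v) ω)) (Σᵇ d (λ v → F (true ∷ v) ω)))) (trans (+-homo _ _)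
        (cong₂ _+_ (uncorrelated-Σᵇ d e (F ∘ (false ∷_)) G (h ∘ (false ∷_))) (uncorrelated-Σᵇ d e (F ∘ (true ∷_)) G (h ∘ (true ∷_)))))

    -- Additivity of variance, by halving the cube. The cross term pairs only vertices with
    -- different first bits, which are distinct and hence uncorrelated, so the two halves simply
    -- add.
    second-moment-Σᵇ : ∀ d (F : Vec Bool d → Ω → ℚ) →
      (∀ v w → v ≢ w → E (λ ω → F v ω * F w ω) ≡ 0ℚ) → (∀ v → E (λ ω → F v ω * F v ω) ≤ 1ℚ) →
      E (λ ω → Σᵇ d (λ v → F v ω) * Σᵇ d (λ v → F v ω)) ≤ fromℕ (2 ℕ.^ d)
    second-moment-Σᵇ zero    F h h₁ = h₁ []
    second-moment-Σᵇ (suc d) F h h₁ = begin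
      E (λ ω → (A ω + B ω) * (A ω + B ω))               ≡⟨ ≗-cong (λ ω → eq (A ω) (B ω)) ⟩
      E (λ ω → A ω * A ω + (B ω * B ω + (A ω * B ω + A ω * B ω)))
        ≡⟨ trans (+-homo _ _) (cong (E (λ ω → A ω * A ω) +_) (trans (+-homo _ _) (cong (E (λ ω → B ω * B ω) +_) (+-homo _ _)))) ⟩
      E (λ ω → A ω * A ω) + (E (λ ω → B ω * B ω) + (E (λ ω → A ω * B ω) + E (λ ω → A ω * B ω)))
        ≡⟨ cong (λ z → E (λ ω → A ω * A ω) + (E (λ ω → B ω * B ω) + (z + z))) AB≡0 ⟩
      E (λ ω → A ω * A ω) + (E (λ ω → B ω * B ω) + 0ℚ)
        ≤⟨ +-mono-≤ (second-moment-Σᵇ d (F ∘ (false ∷_)) (λ v w v≢w → h _ _ (v≢w ∘ ∷-injectiveʳ)) (h₁ ∘ (false ∷_)))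
             (+-monoˡ-≤ 0ℚ (second-moment-Σᵇ d (F ∘ (true ∷_)) (λ v w v≢w → h _ _ (v≢w ∘ ∷-injectiveʳ)) (h₁ ∘ (true ∷_)))) ⟩
      fromℕ (2 ℕ.^ d) + (fromℕ (2 ℕ.^ d) + 0ℚ)          ≡⟨ cong (fromℕ (2 ℕ.^ d) +_) (fromℕ-+ (2 ℕ.^ d) 0) ⟨
      fromℕ (2 ℕ.^ d) + fromℕ (2 ℕ.^ d ℕ.+ 0)           ≡⟨ fromℕ-+ (2 ℕ.^ d) (2 ℕ.^ d ℕ.+ 0) ⟨
      fromℕ (2 ℕ.^ suc d)                               ∎
      where
      open ≤-Reasoning
      A B : Ω → ℚ
      A ω = Σᵇ d (λ v → F (false ∷ v) ω)
      B ω = Σᵇ d (λ v → F (true ∷ v) ω)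
      AB≡0 : E (λ ω → A ω * B ω) ≡ 0ℚ
      AB≡0 = uncorrelated-Σᵇ d d (F ∘ (false ∷_)) (F ∘ (true ∷_)) (λ v w → h _ _ (λ ()))
      eq : ∀ a b → (a + b) * (a + b) ≡ a * a + (b * b + (a * b + a * b))
      eq = solve-∀ ℚ-ring

  module _ {n} (x : Vec Bool n) where
    𝔼-mono : ∀ {A : Set} (c : Comp n A) {f g : A → ℚ} → (∀ a → f a ≤ g a) → 𝔼 x c f ≤ 𝔼 x c g
    𝔼-mono (return a)  h = h a
    𝔼-mono (toss k c)  h = IsExpectation.mono (avg-isExpectation k) (λ i → 𝔼-mono (c i) h)
    𝔼-mono (query i c) h = 𝔼-mono (c (lookup x i)) h

    𝔼-const : ∀ {A : Set} (c : Comp n A) q → 𝔼 x c (λ _ → q) ≡ q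
    𝔼-const (return a)  q = refl
    𝔼-const (toss k c)  q = trans (IsExpectation.≗-cong (avg-isExpectation k) (λ i → 𝔼-const (c i) q)) (IsExpectation.const (avg-isExpectation k) q)
    𝔼-const (query i c) q = 𝔼-const (c (lookup x i)) q

    𝔼-≤ : ∀ {A : Set} (c : Comp n A) {f : A → ℚ} {q} → (∀ a → f a ≤ q) → 𝔼 x c f ≤ q
    𝔼-≤ c h = ≤-trans (𝔼-mono c h) (≤-reflexive (𝔼-const c _))

    𝔼-≥ : ∀ {A : Set} (c : Comp n A) {f : A → ℚ} {q} → (∀ a → q ≤ f a) → q ≤ 𝔼 x c f
    𝔼-≥ c h = ≤-trans (≤-reflexive (sym (𝔼-const c _))) (𝔼-mono c h)

  -- Pairwise independence in ℤ/N

  module Cyclic (M : ℕ) where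
    N : ℕ
    N = suc M

    -- Functions on ℤ/N are represented by periodic functions on ℕ, so that sample points are
    -- ordinary polynomials in the seed and reduction is needed only where a mean is reindexed.
    Periodic : (ℕ → ℚ) → Set
    Periodic P = ∀ y → P (y % N) ≡ P y

    Unit : ℕ → Set
    Unit c = ∃[ c′ ] ∃[ e ] c ℕ.* c′ ≡ 1 ℕ.+ e ℕ.* N

    mean : (ℕ → ℚ) → ℚ
    mean P = avg M (P ∘ toℕ)

    module avg = IsExpectation (avg-isExpectation M)

    %-affine : ∀ c u y → (c ℕ.* (y % N) ℕ.+ u) % N ≡ (c ℕ.* y ℕ.+ u) % N
    %-affine c u y = begin
      (c ℕ.* (y % N) ℕ.+ u) % N                                  ≡⟨ [m+kn]%n≡m%n (c ℕ.* (y % N) ℕ.+ u) (c ℕ.* (y ℕ./ N)) N ⟨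
      (c ℕ.* (y % N) ℕ.+ u ℕ.+ c ℕ.* (y ℕ./ N) ℕ.* N) % N        ≡⟨ cong (_% N) (eq c (y % N) u (y ℕ./ N) N) ⟩
      (c ℕ.* (y % N ℕ.+ y ℕ./ N ℕ.* N) ℕ.+ u) % N                ≡⟨ cong (λ z → (c ℕ.* z ℕ.+ u) % N) (m≡m%n+[m/n]*n y N) ⟨
      (c ℕ.* y ℕ.+ u) % N                                        ∎
      where
      open ≡-Reasoning
      eq : ∀ c r u q N → c ℕ.* r ℕ.+ u ℕ.+ c ℕ.* q ℕ.* N ≡ c ℕ.* (r ℕ.+ q ℕ.* N) ℕ.+ u
      eq = ℕ-Ring.solve-∀

    affine : ∀ c u → Unit c → Permutation′ N
    affine c u (c′ , e , cc′≡1) = permutation to from to∘from from∘to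
      where
      to from : Fin N → Fin N
      to i   = (c ℕ.* toℕ i ℕ.+ u) mod N
      -- `M` is -1 modulo `N`, so adding `M * u` subtracts `u` without leaving ℕ.
      from i = (c′ ℕ.* (toℕ i ℕ.+ M ℕ.* u)) mod N

      reduce : ∀ (i : Fin N) m k → m ≡ toℕ i ℕ.+ k ℕ.* N → m % N ≡ toℕ i
      reduce i m k eq = trans (cong (_% N) eq) (trans ([m+kn]%n≡m%n (toℕ i) k N) (m<n⇒m%n≡m (Fin.toℕ<n i)))

      eq₁ : ∀ c c′ e M i u → c ℕ.* c′ ≡ 1 ℕ.+ e ℕ.* suc M →
        c ℕ.* (c′ ℕ.* (i ℕ.+ M ℕ.* u)) ℕ.+ u ≡ i ℕ.+ (u ℕ.+ e ℕ.* (i ℕ.+ M ℕ.* u)) ℕ.* suc M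
      eq₁ c c′ e M i u h = trans (cong (ℕ._+ u) (sym (ℕ.*-assoc c c′ (i ℕ.+ M ℕ.* u))))
        (trans (cong (λ z → z ℕ.* (i ℕ.+ M ℕ.* u) ℕ.+ u) h) (poly e M i u))
        where
        poly : ∀ e M i u → (1 ℕ.+ e ℕ.* suc M) ℕ.* (i ℕ.+ M ℕ.* u) ℕ.+ u ≡ i ℕ.+ (u ℕ.+ e ℕ.* (i ℕ.+ M ℕ.* u)) ℕ.* suc M
        poly = ℕ-Ring.solve-∀

      eq₂ : ∀ c c′ e M i u → c ℕ.* c′ ≡ 1 ℕ.+ e ℕ.* suc M →
        c′ ℕ.* (c ℕ.* i ℕ.+ u ℕ.+ M ℕ.* u) ≡ i ℕ.+ (e ℕ.* i ℕ.+ c′ ℕ.* u) ℕ.* suc M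
      eq₂ c c′ e M i u h = trans (poly c c′ M i u) (trans (cong (λ z → z ℕ.* i ℕ.+ c′ ℕ.* u ℕ.* suc M) h) (poly′ c′ e M i u))
        where
        poly : ∀ c c′ M i u → c′ ℕ.* (c ℕ.* i ℕ.+ u ℕ.+ M ℕ.* u) ≡ c ℕ.* c′ ℕ.* i ℕ.+ c′ ℕ.* u ℕ.* suc M
        poly = ℕ-Ring.solve-∀
        poly′ : ∀ c′ e M i u → (1 ℕ.+ e ℕ.* suc M) ℕ.* i ℕ.+ c′ ℕ.* u ℕ.* suc M ≡ i ℕ.+ (e ℕ.* i ℕ.+ c′ ℕ.* u) ℕ.* suc M
        poly′ = ℕ-Ring.solve-∀

      to∘from : ∀ i → to (from i) ≡ i
      to∘from i = Fin.toℕ-injective (begin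
        toℕ (to (from i))                                        ≡⟨ Fin.toℕ-fromℕ< _ ⟩
        (c ℕ.* toℕ (from i) ℕ.+ u) % N                           ≡⟨ cong (λ z → (c ℕ.* z ℕ.+ u) % N) (Fin.toℕ-fromℕ< (m%n<n (c′ ℕ.* (toℕ i ℕ.+ M ℕ.* u)) N)) ⟩
        (c ℕ.* ((c′ ℕ.* (toℕ i ℕ.+ M ℕ.* u)) % N) ℕ.+ u) % N     ≡⟨ %-affine c u (c′ ℕ.* (toℕ i ℕ.+ M ℕ.* u)) ⟩
        (c ℕ.* (c′ ℕ.* (toℕ i ℕ.+ M ℕ.* u)) ℕ.+ u) % N           ≡⟨ reduce i _ (u ℕ.+ e ℕ.* (toℕ i ℕ.+ M ℕ.* u)) (eq₁ c c′ e M (toℕ i) u cc′≡1) ⟩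
        toℕ i                                                    ∎)
        where open ≡-Reasoning

      from∘to : ∀ i → from (to i) ≡ i
      from∘to i = Fin.toℕ-injective (begin
        toℕ (from (to i))                                        ≡⟨ Fin.toℕ-fromℕ< _ ⟩
        (c′ ℕ.* (toℕ (to i) ℕ.+ M ℕ.* u)) % N                    ≡⟨ cong (λ z → (c′ ℕ.* (z ℕ.+ M ℕ.* u)) % N) (Fin.toℕ-fromℕ< (m%n<n (c ℕ.* toℕ i ℕ.+ u) N)) ⟩
        (c′ ℕ.* ((c ℕ.* toℕ i ℕ.+ u) % N ℕ.+ M ℕ.* u)) % N       ≡⟨ cong (_% N) (ℕ.*-distribˡ-+ c′ _ (M ℕ.* u)) ⟩
        (c′ ℕ.* ((c ℕ.* toℕ i ℕ.+ u) % N) ℕ.+ c′ ℕ.* (M ℕ.* u)) % N ≡⟨ %-affine c′ (c′ ℕ.* (M ℕ.* u)) (c ℕ.* toℕ i ℕ.+ u) ⟩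
        (c′ ℕ.* (c ℕ.* toℕ i ℕ.+ u) ℕ.+ c′ ℕ.* (M ℕ.* u)) % N    ≡⟨ cong (_% N) (ℕ.*-distribˡ-+ c′ _ (M ℕ.* u)) ⟨
        (c′ ℕ.* (c ℕ.* toℕ i ℕ.+ u ℕ.+ M ℕ.* u)) % N             ≡⟨ reduce i _ (e ℕ.* toℕ i ℕ.+ c′ ℕ.* u) (eq₂ c c′ e M (toℕ i) u cc′≡1) ⟩
        toℕ i                                                    ∎)
        where open ≡-Reasoning

    mean-affine : ∀ c u → Unit c → ∀ {P} → Periodic P → mean (λ y → P (c ℕ.* y ℕ.+ u)) ≡ mean P
    mean-affine c u unit {P} per = sym (trans (cong (1/suc M *_) (Σℚ.sum-permute (P ∘ toℕ) (affine c u unit)))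
      (avg.≗-cong (λ i → trans (cong P (Fin.toℕ-fromℕ< (m%n<n (c ℕ.* toℕ i ℕ.+ u) N))) (per (c ℕ.* toℕ i ℕ.+ u)))))

    periodic-+ : ∀ {P} → Periodic P → ∀ u y → P (y % N ℕ.+ u) ≡ P (y ℕ.+ u)
    periodic-+ {P} per u y = trans (sym (per _)) (trans (cong P
      (subst₂ (λ a b → (a ℕ.+ u) % N ≡ (b ℕ.+ u) % N) (ℕ.*-identityˡ (y % N)) (ℕ.*-identityˡ y) (%-affine 1 u y))) (per _))

    1-unit : Unit 1
    1-unit = 1 , 0 , refl

    mean-shift : ∀ u {P} → Periodic P → mean (λ y → P (y ℕ.+ u)) ≡ mean P
    mean-shift u {P} per = trans (avg.≗-cong (λ i → cong (λ z → P (z ℕ.+ u)) (sym (ℕ.*-identityˡ (toℕ i))))) (mean-affine 1 u 1-unit per)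

    -- For fixed `b`, translating `a` by `j b` turns the arguments into `a` and `a + δ b`. For fixed
    -- `a` the second one then runs once through all residues as `b` does, because `δ` is
    -- invertible.
    mean-product : ∀ {P Q} → Periodic P → Periodic Q → ∀ j δ → Unit δ →
      mean (λ a → mean (λ b → P (a ℕ.+ j ℕ.* b) * Q (a ℕ.+ (j ℕ.+ δ) ℕ.* b))) ≡ mean P * mean Q
    mean-product {P} {Q} perP perQ j δ unit = begin
      mean (λ a → mean (λ b → P (a ℕ.+ j ℕ.* b) * Q (a ℕ.+ (j ℕ.+ δ) ℕ.* b)))
        ≡⟨ avg-swap M M (λ a b → P (toℕ a ℕ.+ j ℕ.* toℕ b) * Q (toℕ a ℕ.+ (j ℕ.+ δ) ℕ.* toℕ b)) ⟩
      mean (λ b → mean (λ a → P (a ℕ.+ j ℕ.* b) * Q (a ℕ.+ (j ℕ.+ δ) ℕ.* b)))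
        ≡⟨ avg.≗-cong (λ b → avg.≗-cong (λ a → cong (λ z → P (toℕ a ℕ.+ j ℕ.* toℕ b) * Q z) (eq (toℕ a) j δ (toℕ b)))) ⟩
      mean (λ b → mean (λ a → P (a ℕ.+ j ℕ.* b) * Q (a ℕ.+ j ℕ.* b ℕ.+ δ ℕ.* b)))
        ≡⟨ avg.≗-cong (λ b → mean-shift (j ℕ.* toℕ b) {λ y → P y * Q (y ℕ.+ δ ℕ.* toℕ b)}
                                (λ y → cong₂ _*_ (perP y) (periodic-+ perQ (δ ℕ.* toℕ b) y))) ⟩
      mean (λ b → mean (λ a → P a * Q (a ℕ.+ δ ℕ.* b)))
        ≡⟨ avg-swap M M (λ b a → P (toℕ a) * Q (toℕ a ℕ.+ δ ℕ.* toℕ b)) ⟩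
      mean (λ a → mean (λ b → P a * Q (a ℕ.+ δ ℕ.* b)))
        ≡⟨ avg.≗-cong (λ a → trans (avg.*-homo (P (toℕ a)) (λ b → Q (toℕ a ℕ.+ δ ℕ.* toℕ b))) (cong (P (toℕ a) *_)
             (trans (avg.≗-cong (λ b → cong Q (ℕ.+-comm (toℕ a) (δ ℕ.* toℕ b)))) (mean-affine δ (toℕ a) unit perQ)))) ⟩
      mean (λ a → P a * mean Q)
        ≡⟨ trans (avg.≗-cong (λ a → *-comm (P (toℕ a)) (mean Q))) (trans (avg.*-homo (mean Q) (P ∘ toℕ)) (*-comm (mean Q) (mean P))) ⟩
      mean P * mean Q ∎
      where
      open ≡-Reasoning
      eq : ∀ a j δ b → a ℕ.+ (j ℕ.+ δ) ℕ.* b ≡ a ℕ.+ j ℕ.* b ℕ.+ δ ℕ.* b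
      eq = ℕ-Ring.solve-∀

    mean³ : (ℕ → ℕ → ℕ → ℚ) → ℚ
    mean³ G = mean (λ a → mean (λ b → mean (λ c → G a b c)))

    mean³-cong : ∀ {F G} → (∀ a b c → F a b c ≡ G a b c) → mean³ F ≡ mean³ G
    mean³-cong h = avg.≗-cong (λ a → avg.≗-cong (λ b → avg.≗-cong (λ c → h (toℕ a) (toℕ b) (toℕ c))))

    module _ {f : ℕ → ℚ} (per : Periodic f) (centred : mean f ≡ 0ℚ) where

      private
        Vanishes : ℕ → ℕ → ℕ → ℕ → Set
        Vanishes j₁ j₂ k₁ k₂ = mean³ (λ a b c → f (a ℕ.+ (j₁ ℕ.* b ℕ.+ j₂ ℕ.* c)) * f (a ℕ.+ (k₁ ℕ.* b ℕ.+ k₂ ℕ.* c))) ≡ 0ℚ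

        -- With `b` held fixed its multiples are mere translations of `f`, so `mean-product` in `a`
        -- and `c` factors the mean, and translates of a centred function are centred.
        by-second : ∀ j₁ j₂ k₁ δ → Unit δ → Vanishes j₁ j₂ k₁ (j₂ ℕ.+ δ)
        by-second j₁ j₂ k₁ δ unit = begin
          mean³ (λ a b c → f (a ℕ.+ (j₁ ℕ.* b ℕ.+ j₂ ℕ.* c)) * f (a ℕ.+ (k₁ ℕ.* b ℕ.+ (j₂ ℕ.+ δ) ℕ.* c)))
            ≡⟨ mean³-cong (λ a b c → cong₂ (λ y z → f y * f z) (eq a (j₁ ℕ.* b) (j₂ ℕ.* c)) (eq a (k₁ ℕ.* b) ((j₂ ℕ.+ δ) ℕ.* c))) ⟩
          mean³ (λ a b c → f (a ℕ.+ j₂ ℕ.* c ℕ.+ j₁ ℕ.* b) * f (a ℕ.+ (j₂ ℕ.+ δ) ℕ.* c ℕ.+ k₁ ℕ.* b))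
            ≡⟨ avg-swap M M (λ a b → mean (λ c → f (toℕ a ℕ.+ j₂ ℕ.* c ℕ.+ j₁ ℕ.* toℕ b) * f (toℕ a ℕ.+ (j₂ ℕ.+ δ) ℕ.* c ℕ.+ k₁ ℕ.* toℕ b))) ⟩
          mean (λ b → mean (λ a → mean (λ c → f (a ℕ.+ j₂ ℕ.* c ℕ.+ j₁ ℕ.* b) * f (a ℕ.+ (j₂ ℕ.+ δ) ℕ.* c ℕ.+ k₁ ℕ.* b))))
            ≡⟨ avg.≗-cong (λ b → mean-product {λ y → f (y ℕ.+ j₁ ℕ.* toℕ b)} {λ y → f (y ℕ.+ k₁ ℕ.* toℕ b)}
                 (periodic-+ per (j₁ ℕ.* toℕ b)) (periodic-+ per (k₁ ℕ.* toℕ b)) j₂ δ unit) ⟩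
          mean (λ b → mean (λ y → f (y ℕ.+ j₁ ℕ.* b)) * mean (λ y → f (y ℕ.+ k₁ ℕ.* b)))
            ≡⟨ avg.≗-cong (λ b → trans (cong (_* mean (λ y → f (y ℕ.+ k₁ ℕ.* toℕ b))) (trans (mean-shift (j₁ ℕ.* toℕ b) per) centred)) (*-zeroˡ (mean (λ y → f (y ℕ.+ k₁ ℕ.* toℕ b))))) ⟩
          mean (λ _ → 0ℚ) ≡⟨ avg.const 0ℚ ⟩
          0ℚ ∎
          where
          open ≡-Reasoning
          eq : ∀ a u v → a ℕ.+ (u ℕ.+ v) ≡ a ℕ.+ v ℕ.+ u
          eq = ℕ-Ring.solve-∀

        flip-factors : ∀ j₁ j₂ k₁ k₂ → Vanishes j₁ j₂ k₁ k₂ → Vanishes k₁ k₂ j₁ j₂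
        flip-factors j₁ j₂ k₁ k₂ v = trans (mean³-cong (λ a b c → *-comm (f (a ℕ.+ (k₁ ℕ.* b ℕ.+ k₂ ℕ.* c))) (f (a ℕ.+ (j₁ ℕ.* b ℕ.+ j₂ ℕ.* c))))) v

        flip-steps : ∀ j₁ j₂ k₁ k₂ → Vanishes j₁ j₂ k₁ k₂ → Vanishes j₂ j₁ k₂ k₁
        flip-steps j₁ j₂ k₁ k₂ v = trans (avg.≗-cong (λ a → avg-swap M M (λ b c → g (toℕ a) (toℕ b) (toℕ c))))
          (trans (mean³-cong (λ a c b → cong₂ (λ y z → f (a ℕ.+ y) * f (a ℕ.+ z)) (ℕ.+-comm (j₂ ℕ.* b) (j₁ ℕ.* c)) (ℕ.+-comm (k₂ ℕ.* b) (k₁ ℕ.* c)))) v)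
          where
          g : ℕ → ℕ → ℕ → ℚ
          g a b c = f (a ℕ.+ (j₂ ℕ.* b ℕ.+ j₁ ℕ.* c)) * f (a ℕ.+ (k₂ ℕ.* b ℕ.+ k₁ ℕ.* c))

      module _ (T : ℕ) (unit : ∀ δ → 0 ℕ.< δ → δ ℕ.≤ T → Unit δ) where

        private
          differ-second : ∀ j₁ j₂ k₁ k₂ → j₂ ℕ.≤ T → k₂ ℕ.≤ T → j₂ ≢ k₂ → Vanishes j₁ j₂ k₁ k₂
          differ-second j₁ j₂ k₁ k₂ j₂≤T k₂≤T j₂≢k₂ with ℕ.<-cmp j₂ k₂
          ... | tri≈ _ j₂≡k₂ _ = contradiction j₂≡k₂ j₂≢k₂
          ... | tri< j₂<k₂ _ _ = subst (Vanishes j₁ j₂ k₁) (ℕ.m+[n∸m]≡n (ℕ.<⇒≤ j₂<k₂))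
                (by-second j₁ j₂ k₁ (k₂ ∸ j₂) (unit (k₂ ∸ j₂) (ℕ.m<n⇒0<n∸m j₂<k₂) (ℕ.≤-trans (ℕ.m∸n≤m k₂ j₂) k₂≤T)))
          ... | tri> _ _ k₂<j₂ = flip-factors k₁ k₂ j₁ j₂ (subst (Vanishes k₁ k₂ j₁) (ℕ.m+[n∸m]≡n (ℕ.<⇒≤ k₂<j₂))
                (by-second k₁ k₂ j₁ (j₂ ∸ k₂) (unit (j₂ ∸ k₂) (ℕ.m<n⇒0<n∸m k₂<j₂) (ℕ.≤-trans (ℕ.m∸n≤m j₂ k₂) j₂≤T))))

        -- The two factors may be exchanged, and so may the roles of `b` and `c`. It remains to
        -- treat second coordinates in increasing order, whose difference lies between 1 and `T`.
        -- The other coordinate is irrelevant, so only differences up to the side of the grid have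
        -- to be invertible.
        uncorrelated : ∀ j₁ j₂ k₁ k₂ → j₁ ℕ.≤ T → j₂ ℕ.≤ T → k₁ ℕ.≤ T → k₂ ℕ.≤ T → j₁ ≢ k₁ ⊎ j₂ ≢ k₂ →
          mean³ (λ a b c → f (a ℕ.+ (j₁ ℕ.* b ℕ.+ j₂ ℕ.* c)) * f (a ℕ.+ (k₁ ℕ.* b ℕ.+ k₂ ℕ.* c))) ≡ 0ℚ
        uncorrelated j₁ j₂ k₁ k₂ j₁≤T j₂≤T k₁≤T k₂≤T (inj₁ ≢) = flip-steps j₂ j₁ k₂ k₁ (differ-second j₂ j₁ k₂ k₁ j₁≤T k₁≤T ≢)
        uncorrelated j₁ j₂ k₁ k₂ j₁≤T j₂≤T k₁≤T k₂≤T (inj₂ ≢) = differ-second j₁ j₂ k₁ k₂ j₂≤T k₂≤T ≢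

  ∣n! : ∀ {m n} → 0 ℕ.< m → m ℕ.≤ n → m ∣ n !
  ∣n! {suc m} _ m≤n = ∣-trans (m∣m*n (m !)) (m≤n⇒m!∣n! m≤n)

  -- Modulo N the cofactor of a divisor of M = N - 1 is minus its inverse, so the
  -- inverse is M times the cofactor.
  divisor-unit : ∀ M .{{_ : NonZero M}} {δ} → δ ∣ M → Cyclic.Unit M δ
  divisor-unit (suc M) {δ} (divides q eq) = q ℕ.* suc M , M , (begin
    δ ℕ.* (q ℕ.* suc M)      ≡⟨ ℕ.*-assoc δ q (suc M) ⟨
    δ ℕ.* q ℕ.* suc M        ≡⟨ cong (ℕ._* suc M) (trans (ℕ.*-comm δ q) (sym eq)) ⟩
    suc M ℕ.* suc M          ≡⟨ poly M ⟩
    1 ℕ.+ M ℕ.* suc (suc M)  ∎)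
    where
    open ≡-Reasoning
    poly : ∀ M → suc M ℕ.* suc M ≡ 1 ℕ.+ M ℕ.* suc (suc M)
    poly = ℕ-Ring.solve-∀

  -- Messages and elementary computations

  bit : Bool → ℕ
  bit b = if b then 1 else 0

  bit≤1 : ∀ b → bit b ℕ.≤ 1
  bit≤1 false = z≤n
  bit≤1 true  = ℕ.≤-refl

  fromBits : ∀ {b} → Vec Bool b → ℕ
  fromBits                 []       = 0
  fromBits {b = suc b} (x ∷ xs) = (if x then 2 ^ b else 0) ℕ.+ fromBits xs

  fromBits<2^ : ∀ {b} (xs : Vec Bool b) → fromBits xs ℕ.< 2 ^ b
  fromBits<2^ []           = ℕ.≤-refl
  fromBits<2^ (true ∷ xs)  = ℕ.+-monoʳ-< _ (ℕ.<-≤-trans (fromBits<2^ xs) (ℕ.m≤m+n _ 0))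
  fromBits<2^ (false ∷ xs) = ℕ.<-≤-trans (fromBits<2^ xs) (ℕ.m≤m+n _ _)

  fromBits-injective : ∀ {b} (xs ys : Vec Bool b) → fromBits xs ≡ fromBits ys → xs ≡ ys
  fromBits-injective []           []           _  = refl
  fromBits-injective (true ∷ xs)  (true ∷ ys)  eq = cong (true ∷_) (fromBits-injective xs ys (ℕ.+-cancelˡ-≡ _ _ _ eq))
  fromBits-injective (false ∷ xs) (false ∷ ys) eq = cong (false ∷_) (fromBits-injective xs ys eq)
  fromBits-injective {suc b} (true ∷ xs)  (false ∷ ys) eq =
    contradiction (fromBits<2^ ys) (ℕ.≤⇒≯ (subst (2 ^ b ℕ.≤_) eq (ℕ.m≤m+n (2 ^ b) (fromBits xs))))
  fromBits-injective {suc b} (false ∷ xs) (true ∷ ys)  eq =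
    contradiction (fromBits<2^ xs) (ℕ.≤⇒≯ (subst (2 ^ b ℕ.≤_) (sym eq) (ℕ.m≤m+n (2 ^ b) (fromBits ys))))

  toBits : ∀ b → ℕ → Vec Bool b
  toBits zero    v = []
  toBits (suc b) v with 2 ^ b ℕ.≤? v
  ... | yes _ = true ∷ toBits b (v ∸ 2 ^ b)
  ... | no  _ = false ∷ toBits b v

  fromBits-toBits : ∀ b v → v ℕ.< 2 ^ b → fromBits (toBits b v) ≡ v
  fromBits-toBits zero    zero    _         = refl
  fromBits-toBits zero    (suc v) (s≤s ())
  fromBits-toBits (suc b) v       v< with 2 ^ b ℕ.≤? v
  ... | yes 2^b≤v = trans (cong (2 ^ b ℕ.+_) (fromBits-toBits b (v ∸ 2 ^ b)
                      (ℕ.+-cancelˡ-< (2 ^ b) _ _ (subst₂ ℕ._<_ (sym (ℕ.m+[n∸m]≡n 2^b≤v)) (cong (2 ^ b ℕ.+_) (ℕ.+-identityʳ (2 ^ b))) v<))))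
                      (ℕ.m+[n∸m]≡n 2^b≤v)
  ... | no  2^b≰v = fromBits-toBits b v (ℕ.≰⇒> 2^b≰v)

  pack : ∀ k b → (Fin k → ℕ) → Vec Bool (k ℕ.* b)
  pack k b f = tabulate (λ ij → lookup (toBits b (f (proj₁ (remQuot {k} b ij)))) (proj₂ (remQuot {k} b ij)))

  unpack : ∀ k b → Vec Bool (k ℕ.* b) → Fin k → ℕ
  unpack k b xs i = fromBits (tabulate (λ j → lookup xs (combine i j)))

  unpack-pack : ∀ k b f i → f i ℕ.< 2 ^ b → unpack k b (pack k b f) i ≡ f i
  unpack-pack k b f i fi< = trans (cong fromBits (begin
    tabulate (λ j → lookup (pack k b f) (combine i j)) ≡⟨ tabulate-cong (λ j → trans (lookup∘tabulate _ (combine i j))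
      (cong (λ p → lookup (toBits b (f (proj₁ p))) (proj₂ p)) (Fin.remQuot-combine i j))) ⟩
    tabulate (lookup (toBits b (f i)))                 ≡⟨ tabulate∘lookup _ ⟩
    toBits b (f i)                                     ∎)) (fromBits-toBits b (f i) fi<)
    where open ≡-Reasoning

  -- Finite products and Bernoulli's inequality

  ∏ : ∀ k → (Fin k → ℚ) → ℚ
  ∏ zero    f = 1ℚ
  ∏ (suc k) f = f zero * ∏ k (f ∘ suc)

  0≤∏ : ∀ k {f} → (∀ i → 0ℚ ≤ f i) → 0ℚ ≤ ∏ k f
  0≤∏ zero    h = 0≤fromℕ 1
  0≤∏ (suc k) h = 0≤* (h zero) (0≤∏ k (h ∘ suc))

  ∏-mono : ∀ k {f g} → (∀ i → 0ℚ ≤ f i) → (∀ i → f i ≤ g i) → ∏ k f ≤ ∏ k g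
  ∏-mono zero    0≤f f≤g = ≤-refl
  ∏-mono (suc k) 0≤f f≤g = *-mono (0≤∏ k (0≤f ∘ suc)) (≤-trans (0≤f zero) (f≤g zero)) (f≤g zero) (∏-mono k (0≤f ∘ suc) (f≤g ∘ suc))

  -- A rational substitute for `(1 - γ)^k ≤ exp (- k γ)`. The induction rests on `(1 - γ)(1 + k γ +
  -- γ) = 1 + k γ - (k + 1) γ²`.
  ∏-bernoulli : ∀ k {q γ} → 0ℚ ≤ q → 0ℚ ≤ γ → q + γ ≤ 1ℚ → ∏ k (λ _ → q) * (1ℚ + fromℕ k * γ) ≤ 1ℚ
  ∏-bernoulli zero    {q} {γ} _ _ _ = ≤-reflexive (eq γ)
    where
    eq : ∀ γ → 1ℚ * (1ℚ + 0ℚ * γ) ≡ 1ℚ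
    eq = solve-∀ ℚ-ring
  ∏-bernoulli (suc k) {q} {γ} 0≤q 0≤γ q+γ≤1 = ≤-trans
    (≤-reflexive (trans (cong (λ z → q * p * (1ℚ + z * γ)) (fromℕ-+ 1 k)) (eq q p m γ)))
    (≤-trans (*-monoˡ (0≤∏ k (λ _ → 0≤q)) step) (∏-bernoulli k 0≤q 0≤γ q+γ≤1))
    where
    m = fromℕ k
    p = ∏ k (λ _ → q)
    eq : ∀ q p m γ → q * p * (1ℚ + (1ℚ + m) * γ) ≡ p * (q * (1ℚ + m * γ + γ))
    eq = solve-∀ ℚ-ring
    eq′ : ∀ q m γ → (1ℚ + m * γ) - q * (1ℚ + m * γ + γ) ≡ (1ℚ - (q + γ)) * (1ℚ + m * γ + γ) + (m * γ + γ) * γ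
    eq′ = solve-∀ ℚ-ring
    0≤mγ+γ : 0ℚ ≤ m * γ + γ
    0≤mγ+γ = 0≤+ (0≤* (0≤fromℕ k) 0≤γ) 0≤γ
    step : q * (1ℚ + m * γ + γ) ≤ 1ℚ + m * γ
    step = ≤-by (eq′ q m γ) (0≤+
      (0≤* (p≤q⇒0≤q-p q+γ≤1) (subst (0ℚ ≤_) (sym (+-assoc 1ℚ (m * γ) γ)) (0≤+ (0≤fromℕ 1) 0≤mγ+γ)))
      (0≤* 0≤mγ+γ 0≤γ))

  -- Building blocks of the parties, with their acceptance and query bounds

  coin : Fin 2 → Bool
  coin zero    = false
  coin (suc _) = true

  tossBits : ∀ {n} {A : Set} k → (Vec Bool k → Comp n A) → Comp n A
  tossBits zero    κ = κ []
  tossBits (suc k) κ = toss 1 (λ i → tossBits k (λ v → κ (coin i ∷ v)))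

  branch : ∀ {d} {A : Set} → (Vec Bool d → A) → (Vec Bool d → A) → Vec Bool (suc d) → A
  branch y z (false ∷ v) = y v
  branch y z (true ∷ v)  = z v

  readAll : ∀ {n} {A : Set} d → (Vec Bool d → Fin n) → ((Vec Bool d → Bool) → Comp n A) → Comp n A
  readAll zero    ι κ = query (ι []) (λ y → κ (λ _ → y))
  readAll (suc d) ι κ = readAll d (ι ∘ (false ∷_)) (λ y → readAll d (ι ∘ (true ∷_)) (λ z → κ (branch y z)))

  -- The number and lengths of messages are prescribed in advance, so a verifier that has made up
  -- its mind still plays the remaining rounds, with dummy messages.
  reject : ∀ {n} s → Verifier n s
  reject []            = return false
  reject ((a , b) ∷ s) = return (tabulate (λ _ → false) , λ _ → reject s)

  ⊔-lub-foldr : ∀ {k B} (f : Fin k → ℕ) → (∀ i → f i ℕ.≤ B) → Vector.foldr ℕ._⊔_ 0 f ℕ.≤ B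
  ⊔-lub-foldr {zero}  f h = z≤n
  ⊔-lub-foldr {suc k} f h = ℕ.⊔-lub (h zero) (⊔-lub-foldr (f ∘ suc) (h ∘ suc))

  module _ {n} (x : Vec Bool n) where

    -- Independent bits average a product factor by factor. The prefactor `s` collects the factors
    -- of the bits tossed so far, so the induction needs no statement about conditioning.
    𝔼-tossBits-≤ : ∀ {A : Set} k (κ : Vec Bool k → Comp n A) {f s} (g : Fin k → Bool → ℚ) →
      (∀ v → 𝔼 x (κ v) f ≤ s * ∏ k (λ i → g i (lookup v i))) →
      𝔼 x (tossBits k κ) f ≤ s * ∏ k (λ i → ½ * (g i false + g i true))
    𝔼-tossBits-≤ zero    κ g h = h []
    𝔼-tossBits-≤ (suc k) κ {f} {s} g h = begin
      ½ * (X false + (X true + 0ℚ))                       ≤⟨ *-monoˡ (0≤1/suc 1) (+-mono-≤ (half false) (+-monoˡ-≤ 0ℚ (half true))) ⟩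
      ½ * (s * g zero false * R + (s * g zero true * R + 0ℚ)) ≡⟨ eq ½ s (g zero false) (g zero true) R ⟩
      s * (½ * (g zero false + g zero true) * R)          ∎
      where
      open ≤-Reasoning
      X : Bool → ℚ
      X b = 𝔼 x (tossBits k (λ v → κ (b ∷ v))) f
      R = ∏ k (λ i → ½ * (g (suc i) false + g (suc i) true))
      half : ∀ b → X b ≤ s * g zero b * R
      half b = 𝔼-tossBits-≤ k (λ v → κ (b ∷ v)) {s = s * g zero b} (g ∘ suc)
        (λ v → ≤-trans (h (b ∷ v)) (≤-reflexive (sym (*-assoc s (g zero b) (∏ k (λ i → g (suc i) (lookup v i)))))))
      eq : ∀ h s a b R → h * (s * a * R + (s * b * R + 0ℚ)) ≡ s * (h * (a + b) * R)
      eq = solve-∀ ℚ-ring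

    𝔼-tossBits-≥ : ∀ {A : Set} k (κ : Vec Bool k → Comp n A) {f q} →
      (∀ v → q ≤ 𝔼 x (κ v) f) → q ≤ 𝔼 x (tossBits k κ) f
    𝔼-tossBits-≥ zero    κ h = h []
    𝔼-tossBits-≥ (suc k) κ h = ≤-trans (≤-reflexive (sym (IsExpectation.const (avg-isExpectation 1) _)))
      (IsExpectation.mono (avg-isExpectation 1) (λ i → 𝔼-tossBits-≥ k (λ v → κ (coin i ∷ v)) (λ v → h (coin i ∷ v))))

    𝔼-readAll-≥ : ∀ {A : Set} d ι (κ : (Vec Bool d → Bool) → Comp n A) {f q} →
      (∀ y → (∀ v → y v ≡ lookup x (ι v)) → q ≤ 𝔼 x (κ y) f) → q ≤ 𝔼 x (readAll d ι κ) f
    𝔼-readAll-≥ zero    ι κ h = h _ (λ { [] → refl })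
    𝔼-readAll-≥ (suc d) ι κ h = 𝔼-readAll-≥ d (ι ∘ (false ∷_)) _ (λ y y≗ →
      𝔼-readAll-≥ d (ι ∘ (true ∷_)) _ (λ z z≗ →
        h (branch y z) (λ { (false ∷ v) → y≗ v ; (true ∷ v) → z≗ v })))

    𝔼-reject : ∀ s P → Pr[accept] s x (reject s) P ≤ 0ℚ
    𝔼-reject []            P = ≤-refl
    𝔼-reject ((a , b) ∷ s) P = 𝔼-≤ x (P _) (λ (r , P′) → 𝔼-reject s P′)

    worst-free : ∀ {A : Set} (c : Comp n A) {f B} → (∀ a → f a ℕ.≤ B) → worst 0 x c f ℕ.≤ B
    worst-free (return a)  h = h a
    worst-free (toss k c)  h = ⊔-lub-foldr _ (λ i → worst-free (c i) h)
    worst-free (query i c) h = worst-free (c (lookup x i)) h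

    worst-tossBits : ∀ {A : Set} w k (κ : Vec Bool k → Comp n A) {f B} →
      (∀ v → worst w x (κ v) f ℕ.≤ B) → worst w x (tossBits k κ) f ℕ.≤ B
    worst-tossBits w zero    κ h = h []
    worst-tossBits w (suc k) κ h = ⊔-lub-foldr _ (λ i → worst-tossBits w k (λ v → κ (coin i ∷ v)) (λ v → h (coin i ∷ v)))

    worst-readAll : ∀ {A : Set} d ι (κ : (Vec Bool d → Bool) → Comp n A) {f B} →
      (∀ y → worst 1 x (κ y) f ℕ.≤ B) → worst 1 x (readAll d ι κ) f ℕ.≤ 2 ^ d ℕ.+ B
    worst-readAll zero    ι κ h = s≤s (h _)
    worst-readAll (suc d) ι κ {f} {B} h = subst (worst 1 x (readAll (suc d) ι κ) f ℕ.≤_)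
      (trans (sym (ℕ.+-assoc (2 ^ d) (2 ^ d) B)) (cong (λ z → 2 ^ d ℕ.+ z ℕ.+ B) (sym (ℕ.+-identityʳ (2 ^ d)))))
      (worst-readAll d (ι ∘ (false ∷_)) _ (λ y → worst-readAll d (ι ∘ (true ∷_)) _ (λ z → h (branch y z))))

    queryCost-reject : ∀ s P → queryCost 1 0 s x (reject s) P ℕ.≤ 0
    queryCost-reject []            P = z≤n
    queryCost-reject ((a , b) ∷ s) P = worst-free (P _) (λ (r , P′) → queryCost-reject s P′)

  -- The tree protocol

  weight : ∀ e → (Vec Bool e → Bool) → ℕ
  weight zero    y = bit (y [])
  weight (suc e) y = weight e (y ∘ (false ∷_)) ℕ.+ weight e (y ∘ (true ∷_))

  weight≤2^ : ∀ e y → weight e y ℕ.≤ 2 ^ e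
  weight≤2^ zero    y = bit≤1 (y [])
  weight≤2^ (suc e) y = ℕ.+-mono-≤ (weight≤2^ e _) (ℕ.≤-trans (weight≤2^ e _) (ℕ.m≤m+n _ 0))

  weight-cong : ∀ e {y z} → (∀ v → y v ≡ z v) → weight e y ≡ weight e z
  weight-cong zero    h = cong bit (h [])
  weight-cong (suc e) h = cong₂ ℕ._+_ (weight-cong e (h ∘ (false ∷_))) (weight-cong e (h ∘ (true ∷_)))

  -- Clamping keeps each half of a claim c ≤ 2^(e+1) within 2^e: without this bound
  -- the error of one half could exceed the number of leaves below it.
  left : ℕ → ℕ → ℕ → ℕ
  left e c l = (l ℕ.⊓ (c ℕ.⊓ 2 ^ e)) ℕ.⊔ (c ∸ 2 ^ e)

  -- Only the left half is sent. The right half is what remains, so the two add up to the claim by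
  -- construction and no consistency check can fail.
  subclaim : ℕ → ℕ → ℕ → Bool → ℕ
  subclaim e c l false = left e c l
  subclaim e c l true  = c ∸ left e c l

  module _ {e c : ℕ} (c≤ : c ℕ.≤ 2 ^ suc e) where
    c∸2^e≤2^e : c ∸ 2 ^ e ℕ.≤ 2 ^ e
    c∸2^e≤2^e = ℕ.m≤n+o⇒m∸n≤o c (2 ^ e) (subst (c ℕ.≤_) (cong (2 ^ e ℕ.+_) (ℕ.+-identityʳ _)) c≤)

    left≤c : ∀ l → left e c l ℕ.≤ c
    left≤c l = ℕ.⊔-lub (ℕ.≤-trans (ℕ.m⊓n≤n l _) (ℕ.m⊓n≤m c _)) (ℕ.m∸n≤m c (2 ^ e))

    subclaim≤ : ∀ l b → subclaim e c l b ℕ.≤ 2 ^ e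
    subclaim≤ l false = ℕ.⊔-lub (ℕ.≤-trans (ℕ.m⊓n≤n l _) (ℕ.m⊓n≤n c _)) c∸2^e≤2^e
    subclaim≤ l true  = ℕ.m≤n+o⇒m∸n≤o c (left e c l) (ℕ.≤-trans (ℕ.m≤n+m∸n c (2 ^ e))
      (subst (ℕ._≤ left e c l ℕ.+ 2 ^ e) (ℕ.+-comm (c ∸ 2 ^ e) (2 ^ e)) (ℕ.+-monoˡ-≤ (2 ^ e) (ℕ.m≤n⊔m _ (c ∸ 2 ^ e)))))

  -- Clamping never alters a true count, which is what makes the tree perfectly complete.
  left-honest : ∀ e u v → u ℕ.≤ 2 ^ e → v ℕ.≤ 2 ^ e → left e (u ℕ.+ v) u ≡ u
  left-honest e u v u≤ v≤ = begin
    (u ℕ.⊓ ((u ℕ.+ v) ℕ.⊓ 2 ^ e)) ℕ.⊔ (u ℕ.+ v ∸ 2 ^ e) ≡⟨ cong (ℕ._⊔ (u ℕ.+ v ∸ 2 ^ e)) (ℕ.m≤n⇒m⊓n≡m (ℕ.⊓-glb (ℕ.m≤m+n u v) u≤)) ⟩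
    u ℕ.⊔ (u ℕ.+ v ∸ 2 ^ e)                           ≡⟨ ℕ.m≥n⇒m⊔n≡m (ℕ.m≤n+o⇒m∸n≤o (u ℕ.+ v) (2 ^ e)
                                                             (subst (u ℕ.+ v ℕ.≤_) (ℕ.+-comm u (2 ^ e)) (ℕ.+-monoʳ-≤ u v≤))) ⟩
    u                                                 ∎
    where open ≡-Reasoning

  -- The triangle inequality for the two errors, stated for the complementary numbers of leaves. The
  -- four bounds by `A` keep both truncated subtractions exact; for the claims they come from the
  -- clamping.
  agreement-superadditive : ∀ A l r u v → l ℕ.≤ A → r ℕ.≤ A → u ℕ.≤ A → v ℕ.≤ A →
    (A ∸ ℕ.∣ l - u ∣) ℕ.+ (A ∸ ℕ.∣ r - v ∣) ℕ.≤ 2 ℕ.* A ∸ ℕ.∣ l ℕ.+ r - u ℕ.+ v ∣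
  agreement-superadditive A l r u v l≤ r≤ u≤ v≤ = ℕ.m+n≤o⇒m≤o∸n _ (begin
    (A ∸ p) ℕ.+ (A ∸ q) ℕ.+ ℕ.∣ l ℕ.+ r - u ℕ.+ v ∣ ≤⟨ ℕ.+-monoʳ-≤ _ triangle ⟩
    (A ∸ p) ℕ.+ (A ∸ q) ℕ.+ (p ℕ.+ q)              ≡⟨ eq (A ∸ p) (A ∸ q) p q ⟩
    (A ∸ p ℕ.+ p) ℕ.+ ((A ∸ q ℕ.+ q) ℕ.+ 0)        ≡⟨ cong₂ (λ a b → a ℕ.+ (b ℕ.+ 0)) (ℕ.m∸n+n≡m p≤A) (ℕ.m∸n+n≡m q≤A) ⟩
    2 ℕ.* A                                       ∎)
    where
    open ℕ.≤-Reasoning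
    p = ℕ.∣ l - u ∣
    q = ℕ.∣ r - v ∣
    p≤A : p ℕ.≤ A
    p≤A = ℕ.≤-trans (ℕ.∣m-n∣≤m⊔n l u) (ℕ.⊔-lub l≤ u≤)
    q≤A : q ℕ.≤ A
    q≤A = ℕ.≤-trans (ℕ.∣m-n∣≤m⊔n r v) (ℕ.⊔-lub r≤ v≤)
    eq : ∀ a b p q → a ℕ.+ b ℕ.+ (p ℕ.+ q) ≡ (a ℕ.+ p) ℕ.+ ((b ℕ.+ q) ℕ.+ 0)
    eq = ℕ-Ring.solve-∀
    triangle : ℕ.∣ l ℕ.+ r - u ℕ.+ v ∣ ℕ.≤ p ℕ.+ q
    triangle = ℕ.≤-trans (ℕ.∣-∣-triangle (l ℕ.+ r) (u ℕ.+ r) (u ℕ.+ v))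
      (ℕ.≤-reflexive (cong₂ ℕ._+_
        (trans (cong₂ ℕ.∣_-_∣ (ℕ.+-comm l r) (ℕ.+-comm u r)) (ℕ.∣m+n-m+o∣≡∣n-o∣ r l u))
        (ℕ.∣m+n-m+o∣≡∣n-o∣ u r v)))

  ½^ : ℕ → ℚ
  ½^ zero    = 1ℚ
  ½^ (suc e) = ½ * ½^ e

  0≤½^ : ∀ e → 0ℚ ≤ ½^ e
  0≤½^ zero    = 0≤fromℕ 1
  0≤½^ (suc e) = 0≤* (0≤1/suc 1) (0≤½^ e)

  ½^-inverse : ∀ e → ½^ e * fromℕ (2 ^ e) ≡ 1ℚ
  ½^-inverse zero    = refl
  ½^-inverse (suc e) = trans (cong (½ * ½^ e *_) (fromℕ-* 2 (2 ^ e)))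
    (trans (eq (½^ e) (fromℕ (2 ^ e))) (½^-inverse e))
    where
    eq : ∀ h t → ½ * h * (fromℕ 2 * t) ≡ h * t
    eq = solve-∀ ℚ-ring

  -- One minus the error of the claim as a fraction of the leaves: it will bound the probability
  -- that a single random path from this node ends at a correctly claimed leaf.
  score : ℕ → ℕ → ℕ → ℚ
  score e c w = fromℕ (2 ^ e ∸ ℕ.∣ c - w ∣) * ½^ e

  0≤score : ∀ e c w → 0ℚ ≤ score e c w
  0≤score e c w = 0≤* (0≤fromℕ (2 ^ e ∸ ℕ.∣ c - w ∣)) (0≤½^ e)

  score-agree : ∀ c w → T (c ℕ.≡ᵇ w) → score 0 c w ≡ 1ℚ
  score-agree c w t = cong (λ z → fromℕ (1 ∸ z) * 1ℚ) (ℕ.m≡n⇒∣m-n∣≡0 (ℕ.≡ᵇ⇒≡ c w t))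

  -- Along a random path the score is a supermartingale, whatever value `l` the prover sends.
  score-average : ∀ e c l u v → c ℕ.≤ 2 ^ suc e → u ℕ.≤ 2 ^ e → v ℕ.≤ 2 ^ e →
    ½ * (score e (subclaim e c l false) u + score e (subclaim e c l true) v) ≤ score (suc e) c (u ℕ.+ v)
  score-average e c l u v c≤ u≤ v≤ = begin
    ½ * (fromℕ a * h + fromℕ b * h) ≡⟨ eq ½ (fromℕ a) (fromℕ b) h ⟩
    (fromℕ a + fromℕ b) * (½ * h)   ≡⟨ cong (_* (½ * h)) (fromℕ-+ a b) ⟨
    fromℕ (a ℕ.+ b) * (½ * h)       ≤⟨ *-monoʳ (0≤½^ (suc e)) (fromℕ-mono (subst
                                        (λ z → a ℕ.+ b ℕ.≤ 2 ^ suc e ∸ ℕ.∣ z - u ℕ.+ v ∣) (ℕ.m+[n∸m]≡n (left≤c {e} {c} c≤ l))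
                                        (agreement-superadditive (2 ^ e) _ _ u v (subclaim≤ {e} {c} c≤ l false) (subclaim≤ {e} {c} c≤ l true) u≤ v≤))) ⟩
    score (suc e) c (u ℕ.+ v)       ∎
    where
    open ≤-Reasoning
    h = ½^ e
    a = 2 ^ e ∸ ℕ.∣ subclaim e c l false - u ∣
    b = 2 ^ e ∸ ℕ.∣ subclaim e c l true - v ∣
    eq : ∀ k a b h → k * (a * h + b * h) ≡ (a + b) * (k * h)
    eq = solve-∀ ℚ-ring

  -- Two rounds per level of the tree: k left weights of b bits each from the prover,
  -- then k random directions from the verifier.
  treeShape : ℕ → ℕ → ℕ → Shape
  treeShape k b zero    = []
  treeShape k b (suc e) = (0 , k ℕ.* b) ∷ (k , 0) ∷ treeShape k b e

  checkLeaves : ∀ {n} k → (Fin k → ℕ) → (Fin k → Fin n) → Comp n Bool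
  checkLeaves zero    c ι = return true
  checkLeaves (suc k) c ι = query (ι zero) (λ y →
    if c zero ℕ.≡ᵇ bit y then checkLeaves k (c ∘ suc) (ι ∘ suc) else return false)

  treeVerifier : ∀ {n} k b e → (Fin k → ℕ) → (Fin k → Vec Bool e → Fin n) → Verifier n (treeShape k b e)
  treeVerifier k b zero    c ι = checkLeaves k c (λ i → ι i [])
  treeVerifier k b (suc e) c ι = return ([] , λ r → tossBits k (λ v → return (v , λ _ →
    treeVerifier k b e (λ i → subclaim e (c i) (unpack k b r i) (lookup v i)) (λ i u → ι i (lookup v i ∷ u)))))

  treeProver : ∀ {n} k b e → (Fin k → Vec Bool e → Bool) → Prover n (treeShape k b e)
  treeProver k b zero    y = tt
  treeProver k b (suc e) y = λ _ → return (pack k b (λ i → weight e (y i ∘ (false ∷_))) , λ v →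
    return ([] , treeProver k b e (λ i u → y i (lookup v i ∷ u))))

  -- Soundness, completeness and query cost of the tree protocol

  module _ {n} (x : Vec Bool n) where

    checkLeaves-sound : ∀ k c ι → 𝔼 x (checkLeaves k c ι) (λ b → if b then 1ℚ else 0ℚ) ≤
      ∏ k (λ i → score 0 (c i) (bit (lookup x (ι i))))
    checkLeaves-sound zero    c ι = ≤-refl
    checkLeaves-sound (suc k) c ι with c zero ℕ.≡ᵇ bit (lookup x (ι zero)) in eq
    ... | false = 0≤∏ (suc k) {λ i → score 0 (c i) (bit (lookup x (ι i)))} (λ i → 0≤score 0 (c i) (bit (lookup x (ι i))))
    ... | true  = ≤-trans (checkLeaves-sound k (c ∘ suc) (ι ∘ suc)) (≤-reflexive (trans (sym (*-identityˡ R))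
      (cong (_* R) (sym (score-agree (c zero) (bit (lookup x (ι zero))) (subst T (sym eq) tt))))))
      where
      R = ∏ k (λ i → score 0 (c (suc i)) (bit (lookup x (ι (suc i)))))

    -- The prover's reply may depend on the state of all `k` paths. Once it is fixed, the next
    -- directions are independent across paths, so the product of the scores at the children
    -- averages factor by factor, and `score-average` bounds each factor.
    treeVerifier-sound : ∀ k b e c ι → (∀ i → c i ℕ.≤ 2 ^ e) → ∀ P →
      Pr[accept] (treeShape k b e) x (treeVerifier k b e c ι) P ≤
      ∏ k (λ i → score e (c i) (weight e (λ v → lookup x (ι i v))))
    treeVerifier-sound k b zero    c ι c≤ P = checkLeaves-sound k c (λ i → ι i [])
    treeVerifier-sound k b (suc e) c ι c≤ P = 𝔼-≤ x (P []) (λ (r , P′) → ≤-trans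
      (𝔼-tossBits-≤ x k (κ r) {s = 1ℚ} (g r) (λ v → ≤-trans
        (𝔼-≤ x (P′ v) (λ (_ , P″) → treeVerifier-sound k b e _ _ (λ i → subclaim≤ {e} {c i} (c≤ i) (unpack k b r i) (lookup v i)) P″))
        (≤-reflexive (sym (*-identityˡ (∏ k (λ i → g r i (lookup v i))))))))
      (≤-trans (≤-reflexive (*-identityˡ (∏ k (λ i → ½ * (g r i false + g r i true)))))
        (∏-mono k (λ i → 0≤* (0≤1/suc 1) (0≤+ (0≤g r i false) (0≤g r i true)))
          (λ i → score-average e (c i) (unpack k b r i) _ _ (c≤ i) (weight≤2^ e _) (weight≤2^ e _)))))
      where
      κ : Vec Bool (k ℕ.* b) → Vec Bool k → Comp n (Vec Bool k × (Vec Bool 0 → Verifier n (treeShape k b e)))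
      κ r v = return (v , λ _ →
        treeVerifier k b e (λ i → subclaim e (c i) (unpack k b r i) (lookup v i)) (λ i u → ι i (lookup v i ∷ u)))
      g : Vec Bool (k ℕ.* b) → Fin k → Bool → ℚ
      g r i d = score e (subclaim e (c i) (unpack k b r i) d) (weight e (λ u → lookup x (ι i (d ∷ u))))
      0≤g : ∀ r i d → 0ℚ ≤ g r i d
      0≤g r i d = 0≤score e (subclaim e (c i) (unpack k b r i) d) (weight e (λ u → lookup x (ι i (d ∷ u))))

    checkLeaves-complete : ∀ k c ι → (∀ i → c i ≡ bit (lookup x (ι i))) →
      1ℚ ≤ 𝔼 x (checkLeaves k c ι) (λ b → if b then 1ℚ else 0ℚ)
    checkLeaves-complete zero    c ι h = ≤-refl
    checkLeaves-complete (suc k) c ι h with c zero ℕ.≡ᵇ bit (lookup x (ι zero)) in eq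
    ... | true  = checkLeaves-complete k (c ∘ suc) (ι ∘ suc) (h ∘ suc)
    ... | false = contradiction (subst T eq (ℕ.≡⇒≡ᵇ (c zero) (bit (lookup x (ι zero))) (h zero))) (λ ())

    treeVerifier-complete : ∀ k b e c ι y → e ℕ.≤ b → (∀ i → c i ≡ weight e (λ v → lookup x (ι i v))) →
      (∀ i v → y i v ≡ lookup x (ι i v)) →
      1ℚ ≤ Pr[accept] (treeShape k b e) x (treeVerifier k b e c ι) (treeProver k b e y)
    treeVerifier-complete k b zero    c ι y e≤b c≡ y≡ = checkLeaves-complete k c (λ i → ι i []) c≡
    treeVerifier-complete k b (suc e) c ι y e≤b c≡ y≡ = 𝔼-tossBits-≥ x k _ (λ v →
      treeVerifier-complete k b e _ _ _ (ℕ.<⇒≤ e≤b) (λ i → honest i (lookup v i)) (λ i u → y≡ i (lookup v i ∷ u)))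
      where
      r = pack k b (λ i → weight e (y i ∘ (false ∷_)))
      w : ∀ i → Bool → ℕ
      w i d = weight e (λ u → lookup x (ι i (d ∷ u)))
      reply : ∀ i → unpack k b r i ≡ w i false
      -- A left weight may equal `2 ^ e`, which does not fit into `e` bits; the hypothesis
      -- `suc e ≤ b` supplies the extra bit.
      reply i = trans (unpack-pack k b _ i (ℕ.≤-<-trans (weight≤2^ e _) (ℕ.^-monoʳ-< 2 (s≤s (s≤s z≤n)) e≤b)))
                  (weight-cong e (y≡ i ∘ (false ∷_)))
      left≡ : ∀ i → left e (c i) (unpack k b r i) ≡ w i false
      left≡ i = trans (cong₂ (left e) (c≡ i) (reply i)) (left-honest e (w i false) (w i true) (weight≤2^ e _) (weight≤2^ e _))
      honest : ∀ i d → subclaim e (c i) (unpack k b r i) d ≡ w i d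
      honest i false = left≡ i
      honest i true  = trans (cong₂ _∸_ (c≡ i) (left≡ i)) (ℕ.m+n∸m≡n (w i false) (w i true))

    worst-checkLeaves : ∀ k c ι → worst 1 x (checkLeaves k c ι) (λ _ → 0) ℕ.≤ k
    worst-checkLeaves zero    c ι = z≤n
    worst-checkLeaves (suc k) c ι with c zero ℕ.≡ᵇ bit (lookup x (ι zero))
    ... | true  = s≤s (worst-checkLeaves k (c ∘ suc) (ι ∘ suc))
    ... | false = s≤s z≤n

    queryCost-treeVerifier : ∀ k b e c ι P → queryCost 1 0 (treeShape k b e) x (treeVerifier k b e c ι) P ℕ.≤ k
    queryCost-treeVerifier k b zero    c ι P = worst-checkLeaves k c (λ i → ι i [])
    queryCost-treeVerifier k b (suc e) c ι P = worst-free x (P []) (λ (r , P′) →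
      worst-tossBits x 1 k _ (λ v → worst-free x (P′ v) (λ (_ , P″) → queryCost-treeVerifier k b e _ _ P″)))

    queryCost-treeProver : ∀ k b e V y → queryCost 0 1 (treeShape k b e) x V (treeProver k b e y) ℕ.≤ 0
    queryCost-treeProver k b zero    V y = worst-free x V (λ _ → z≤n)
    queryCost-treeProver k b (suc e) V y = worst-free x V (λ (_ , V′) →
      worst-free x (V′ _) (λ (_ , V″) → queryCost-treeProver k b e (V″ _) _))

  -- The sample

  Σ< : ℕ → (ℕ → ℚ) → ℚ
  Σ< m g = sumℚ {m} (g ∘ toℕ)

  Σ<-+ : ∀ m k g → Σ< (m ℕ.+ k) g ≡ Σ< m g + Σ< k (g ∘ (m ℕ.+_))
  Σ<-+ zero    k g = sym (+-identityˡ (Σ< k g))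
  Σ<-+ (suc m) k g = trans (cong (g 0 +_) (Σ<-+ m k (g ∘ suc))) (sym (+-assoc (g 0) (Σ< m (g ∘ suc)) (Σ< k (g ∘ (suc m ℕ.+_)))))

  Σ<-periods : ∀ q n g → (∀ i → g (n ℕ.+ i) ≡ g i) → Σ< (q ℕ.* n) g ≡ fromℕ q * Σ< n g
  Σ<-periods zero    n g h = sym (*-zeroˡ (Σ< n g))
  Σ<-periods (suc q) n g h = begin
    Σ< (n ℕ.+ q ℕ.* n) g                          ≡⟨ Σ<-+ n (q ℕ.* n) g ⟩
    Σ< n g + Σ< (q ℕ.* n) (g ∘ (n ℕ.+_))          ≡⟨ cong (Σ< n g +_) (sum-cong-≗ {n = q ℕ.* n} (λ i → h (toℕ i))) ⟩
    Σ< n g + Σ< (q ℕ.* n) g                       ≡⟨ cong (Σ< n g +_) (Σ<-periods q n g h) ⟩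
    Σ< n g + fromℕ q * Σ< n g                     ≡⟨ eq (fromℕ q) (Σ< n g) ⟩
    (1ℚ + fromℕ q) * Σ< n g                       ≡⟨ cong (_* Σ< n g) (fromℕ-+ 1 q) ⟨
    fromℕ (suc q) * Σ< n g                        ∎
    where
    open ≡-Reasoning
    eq : ∀ q s → s + q * s ≡ (1ℚ + q) * s
    eq = solve-∀ ℚ-ring

  sum-bits : ∀ {n} (x : Vec Bool n) → sumℚ (λ i → fromℕ (bit (lookup x i))) ≡ fromℕ (count T? x)
  sum-bits []          = refl
  sum-bits (true ∷ x)  = trans (cong (1ℚ +_) (sum-bits x)) (sym (fromℕ-+ 1 (count T? x)))
  sum-bits (false ∷ x) = trans (+-identityˡ _) (sum-bits x)

  wt-* : ∀ {n} .{{_ : NonZero n}} (x : Vec Bool n) → wt x * fromℕ n ≡ fromℕ (count T? x)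
  wt-* {suc n} x = /-*-cancel (count T? x) n

  count≤n : ∀ {n} (x : Vec Bool n) → count T? x ℕ.≤ n
  count≤n []          = z≤n
  count≤n (true ∷ x)  = s≤s (count≤n x)
  count≤n (false ∷ x) = ℕ.m≤n⇒m≤1+n (count≤n x)

  wt≤1 : ∀ {n} .{{_ : NonZero n}} (x : Vec Bool n) → wt x ≤ 1ℚ
  wt≤1 {suc n} x = /-≤ (count T? x) n 1 0 (subst₂ ℕ._≤_ (sym (ℕ.*-identityʳ _)) (sym (ℕ.*-identityˡ _)) (count≤n x))

  0≤wt : ∀ {n} .{{_ : NonZero n}} (x : Vec Bool n) → 0ℚ ≤ wt x
  0≤wt {suc n} x = /-≤ 0 0 (count T? x) n z≤n

  0≤bit : ∀ b → 0ℚ ≤ fromℕ (bit b)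
  0≤bit b = 0≤fromℕ (bit b)

  bit≤1ℚ : ∀ b → fromℕ (bit b) ≤ 1ℚ
  bit≤1ℚ b = fromℕ-mono (bit≤1 b)

  Σᵇ-centred : ∀ d (y : Vec Bool d → Bool) μ → Σᵇ d (λ v → fromℕ (bit (y v)) - μ) ≡ fromℕ (weight d y) - fromℕ (2 ^ d) * μ
  Σᵇ-centred zero    y μ = cong (λ z → fromℕ (bit (y [])) - z) (sym (*-identityˡ μ))
  Σᵇ-centred (suc d) y μ = begin
    Σᵇ d (λ v → fromℕ (bit (y (false ∷ v))) - μ) + Σᵇ d (λ v → fromℕ (bit (y (true ∷ v))) - μ)
      ≡⟨ cong₂ _+_ (Σᵇ-centred d (y ∘ (false ∷_)) μ) (Σᵇ-centred d (y ∘ (true ∷_)) μ) ⟩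
    (fromℕ u - t * μ) + (fromℕ v - t * μ)    ≡⟨ eq (fromℕ u) (fromℕ v) t μ ⟩
    (fromℕ u + fromℕ v) - fromℕ 2 * t * μ    ≡⟨ cong₂ (λ a b → a - b * μ) (fromℕ-+ u v) (fromℕ-* 2 (2 ^ d)) ⟨
    fromℕ (u ℕ.+ v) - fromℕ (2 ^ suc d) * μ  ∎
    where
    open ≡-Reasoning
    u = weight d (y ∘ (false ∷_))
    v = weight d (y ∘ (true ∷_))
    t = fromℕ (2 ^ d)
    eq : ∀ u v t μ → (u - t * μ) + (v - t * μ) ≡ (u + v) - fromℕ 2 * t * μ
    eq = solve-∀ ℚ-ring

  ½^-+ : ∀ d e → ½^ (d ℕ.+ e) ≡ ½^ d * ½^ e
  ½^-+ zero    e = sym (*-identityˡ (½^ e))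
  ½^-+ (suc d) e = trans (cong (½ *_) (½^-+ d e)) (sym (*-assoc ½ (½^ d) (½^ e)))

  -- The sampling modulus is period n h + 1: every positive number up to 2^h is
  -- invertible modulo it, and reducing its residues further modulo n is uniform
  -- up to the single surplus residue.
  period : ℕ → ℕ → ℕ
  period n h = (2 ^ h) ! ℕ.* n

  -- The two halves of a leaf address v are the coordinates of a cell in a
  -- 2^h × 2^h grid; distinct cells differ invertibly in some coordinate.
  point : (n : ℕ) .{{_ : NonZero n}} (h : ℕ) → ℕ → ℕ → ℕ → Vec Bool (h ℕ.+ h) → Fin n
  point n h a b c v = ((a ℕ.+ (fromBits (take h v) ℕ.* b ℕ.+ fromBits (drop h v) ℕ.* c)) % suc (period n h)) mod n

  n≤n! : ∀ n → n ℕ.≤ n !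
  n≤n! zero    = z≤n
  n≤n! (suc n) = ℕ.m≤m*n (suc n) (n !) {{n ℕ.!≢0}}

  2^h≤period : ∀ n .{{_ : NonZero n}} h → 2 ^ h ℕ.≤ period n h
  2^h≤period n h = ℕ.≤-trans (n≤n! (2 ^ h)) (ℕ.m≤m*n ((2 ^ h) !) n)

  -- Moments of the sample: variance and bias

  module Sampling {n : ℕ} .{{_ : NonZero n}} (x : Vec Bool n) (h : ℕ) where
    M : ℕ
    M = period n h

    open Cyclic M

    -- The reduction modulo `N` comes first because `N` is one more than a multiple of `n`:
    -- reduction modulo `n` alone is in general not `N`-periodic.
    sampled : ℕ → ℚ
    sampled y = fromℕ (bit (lookup x ((y % N) mod n)))

    μ : ℚ
    μ = mean sampled

    private
      f : ℕ → ℚ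
      f y = sampled y - μ

      per : Periodic f
      per y = cong (λ z → fromℕ (bit (lookup x (z mod n))) - μ) (m%n%n≡m%n y N)

      centred : mean f ≡ 0ℚ
      centred = trans (avg.+-homo (sampled ∘ toℕ) (λ _ → - μ)) (trans (cong (μ +_) (avg.const (- μ))) (+-inverseʳ μ))

      unit : ∀ δ → 0 ℕ.< δ → δ ℕ.≤ 2 ^ h → Unit δ
      unit δ 0<δ δ≤ = divisor-unit M {{ℕ.>-nonZero (ℕ.<-≤-trans (ℕ.m^n>0 2 h) (2^h≤period n h))}} (∣-trans (∣n! 0<δ δ≤) (m∣m*n n))

      0≤μ : 0ℚ ≤ μ
      0≤μ = subst (_≤ μ) (avg.const 0ℚ) (avg.mono (λ i → 0≤bit (lookup x ((toℕ i % N) mod n))))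

      μ≤1 : μ ≤ 1ℚ
      μ≤1 = subst (μ ≤_) (avg.const 1ℚ) (avg.mono (λ i → bit≤1ℚ (lookup x ((toℕ i % N) mod n))))

      f*f≤1 : ∀ y → f y * f y ≤ 1ℚ
      f*f≤1 y = ≤-by (eq (sampled y) μ) (0≤*
          (0≤+ (p≤q⇒0≤q-p (bit≤1ℚ (lookup x ((y % N) mod n)))) 0≤μ)
          (0≤+ (0≤bit (lookup x ((y % N) mod n))) (p≤q⇒0≤q-p μ≤1)))
        where
        eq : ∀ β μ → 1ℚ - (β - μ) * (β - μ) ≡ ((1ℚ - β) + μ) * (β + (1ℚ - μ))
        eq = solve-∀ ℚ-ring

    Seed : Set
    Seed = Fin N × Fin N × Fin N

    𝔼seed : (Seed → ℚ) → ℚ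
    𝔼seed F = avg M (λ a → avg M (λ b → avg M (λ c → F (a , b , c))))

    seedExpectation : IsExpectation 𝔼seed
    seedExpectation = ×-isExpectation (avg-isExpectation M) (×-isExpectation (avg-isExpectation M) (avg-isExpectation M))

    d : ℕ
    d = h ℕ.+ h

    sampleWeight : Seed → ℕ
    sampleWeight (a , b , c) = weight d (λ v → lookup x (point n h (toℕ a) (toℕ b) (toℕ c) v))

    error : Seed → ℚ
    error ω = ½^ d * fromℕ (sampleWeight ω) - μ

    private
      coord : Vec Bool d → Seed → ℕ
      coord v (a , b , c) = toℕ a ℕ.+ (fromBits (take h v) ℕ.* toℕ b ℕ.+ fromBits (drop h v) ℕ.* toℕ c)

      Z : Seed → ℚ
      Z ω = Σᵇ d (λ v → f (coord v ω))

      Z² : 𝔼seed (λ ω → Z ω * Z ω) ≤ fromℕ (2 ^ d)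
      Z² = second-moment-Σᵇ seedExpectation d (λ v ω → f (coord v ω)) pairwise
        (λ v → subst (𝔼seed (λ ω → f (coord v ω) * f (coord v ω)) ≤_) (IsExpectation.const seedExpectation 1ℚ)
                 (IsExpectation.mono seedExpectation (λ ω → f*f≤1 (coord v ω))))
        where
        bound : ∀ (v : Vec Bool h) → fromBits v ℕ.≤ 2 ^ h
        bound v = ℕ.<⇒≤ (fromBits<2^ v)
        pairwise : ∀ v w → v ≢ w → 𝔼seed (λ ω → f (coord v ω) * f (coord w ω)) ≡ 0ℚ
        pairwise v w v≢w = uncorrelated {f} per centred (2 ^ h) unit (fromBits (take h v)) (fromBits (drop h v)) (fromBits (take h w)) (fromBits (drop h w))
          (bound (take h v)) (bound (drop h v)) (bound (take h w)) (bound (drop h w)) distinct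
          where
          distinct : fromBits (take h v) ≢ fromBits (take h w) ⊎ fromBits (drop h v) ≢ fromBits (drop h w)
          distinct with fromBits (take h v) ℕ.≟ fromBits (take h w) | fromBits (drop h v) ℕ.≟ fromBits (drop h w)
          ... | no ≢ | _     = inj₁ ≢
          ... | _    | no ≢  = inj₂ ≢
          ... | yes p | yes q = contradiction (trans (sym (take++drop≡id h v))
            (trans (cong₂ _++_ (fromBits-injective (take h v) (take h w) p) (fromBits-injective (drop h v) (drop h w) q)) (take++drop≡id h w))) v≢w

      error≡ : ∀ ω → error ω ≡ ½^ d * Z ω
      error≡ ω = sym (trans (cong (½^ d *_) (Σᵇ-centred d (λ v → lookup x ((coord v ω % N) mod n)) μ))
        (trans (eq (½^ d) (fromℕ (sampleWeight ω)) (fromℕ (2 ^ d)) μ)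
          (cong (λ z → ½^ d * fromℕ (sampleWeight ω) - z) (trans (cong (_* μ) (½^-inverse d)) (*-identityˡ μ)))))
        where
        eq : ∀ h w t μ → h * (w - t * μ) ≡ h * w - h * t * μ
        eq = solve-∀ ℚ-ring

    -- The mean of 4^h uncorrelated variables, each of variance at most 1, has variance at most
    -- 4^(-h). Markov's step is deferred: the scaled square itself will serve as an upper bound for
    -- the indicator of a bad sample.
    chebyshev : ∀ L → 𝔼seed (λ ω → (L * error ω) * (L * error ω)) ≤ (L * ½^ h) * (L * ½^ h)
    chebyshev L = begin
      𝔼seed (λ ω → (L * error ω) * (L * error ω))   ≡⟨ E.≗-cong (λ ω → trans (cong (λ e → (L * e) * (L * e)) (error≡ ω)) (eq L (½^ d) (Z ω))) ⟩
      𝔼seed (λ ω → (L * ½^ d) * (L * ½^ d) * (Z ω * Z ω)) ≡⟨ E.*-homo ((L * ½^ d) * (L * ½^ d)) (λ ω → Z ω * Z ω) ⟩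
      (L * ½^ d) * (L * ½^ d) * 𝔼seed (λ ω → Z ω * Z ω)   ≤⟨ *-monoˡ (0≤sq (L * ½^ d)) Z² ⟩
      (L * ½^ d) * (L * ½^ d) * fromℕ (2 ^ d)       ≡⟨ eq′ L (½^ d) (fromℕ (2 ^ d)) ⟩
      (L * L) * ½^ d * (½^ d * fromℕ (2 ^ d))       ≡⟨ trans (cong ((L * L) * ½^ d *_) (½^-inverse d)) (*-identityʳ _) ⟩
      (L * L) * ½^ d                                ≡⟨ trans (cong ((L * L) *_) (½^-+ h h)) (eq″ L (½^ h)) ⟩
      (L * ½^ h) * (L * ½^ h)                       ∎
      where
      open ≤-Reasoning
      module E = IsExpectation seedExpectation
      eq : ∀ L h z → (L * (h * z)) * (L * (h * z)) ≡ (L * h) * (L * h) * (z * z)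
      eq = solve-∀ ℚ-ring
      eq′ : ∀ L h t → (L * h) * (L * h) * t ≡ (L * L) * h * (h * t)
      eq′ = solve-∀ ℚ-ring
      eq″ : ∀ L h → (L * L) * (h * h) ≡ (L * h) * (L * h)
      eq″ = solve-∀ ℚ-ring

    -- The residues below `M` hit every position exactly `(2 ^ h) !` times. Only the residue `M`,
    -- with value `γ`, disturbs the mean, so the difference is exactly `(γ - wt x) / N`.
    bias : ∣ μ - wt x ∣ ≤ 1/suc M
    bias = subst (_≤ r) (cong ∣_∣ (sym μ-wt≡)) (∣p∣≤
        (subst (r * (γ - wt x) ≤_) (*-identityʳ r) (*-monoˡ (0≤1/suc M) γ-w≤1))
        (subst₂ _≤_ (neg r (γ - wt x)) (*-identityʳ r) (*-monoˡ (0≤1/suc M) w-γ≤1)))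
      where
      r = 1/suc M
      q = (2 ^ h) !
      g : ℕ → ℚ
      g y = fromℕ (bit (lookup x (y mod n)))
      γ = g (M ℕ.+ 0)
      g-cong : ∀ i j → i % n ≡ j % n → g i ≡ g j
      g-cong i j eq = cong (λ z → fromℕ (bit (lookup x z))) (Fin.toℕ-injective (trans (Fin.toℕ-fromℕ< (m%n<n i n)) (trans eq (sym (Fin.toℕ-fromℕ< (m%n<n j n))))))
      total : Σ< n g ≡ wt x * fromℕ n
      total = trans (sum-cong-≗ (λ i → cong (λ z → fromℕ (bit (lookup x z)))
                (Fin.toℕ-injective (trans (Fin.toℕ-fromℕ< (m%n<n (toℕ i) n)) (m<n⇒m%n≡m (Fin.toℕ<n i))))))
                (trans (sum-bits x) (sym (wt-* x)))
      sum≡ : Σ< N g ≡ fromℕ q * (wt x * fromℕ n) + (γ + 0ℚ)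
      sum≡ = trans (cong (λ k → Σ< k g) (ℕ.+-comm 1 M)) (trans (Σ<-+ M 1 g) (cong (_+ (γ + 0ℚ))
        (trans (Σ<-periods q n g (λ i → g-cong (n ℕ.+ i) i (trans (cong (_% n) (ℕ.+-comm n i)) ([m+n]%n≡m%n i n)))) (cong (fromℕ q *_) total))))
      sampled≡ : ∀ (i : Fin N) → sampled (toℕ i) ≡ g (toℕ i)
      sampled≡ i = cong g (m<n⇒m%n≡m (Fin.toℕ<n i))
      r*N≡1 : r * (1ℚ + fromℕ q * fromℕ n) ≡ 1ℚ
      r*N≡1 = trans (cong (r *_) (sym (trans (fromℕ-+ 1 M) (cong (1ℚ +_) (fromℕ-* q n))))) (1/suc-* M)
      eq : ∀ r q w n γ → r * (q * (w * n) + (γ + 0ℚ)) - r * (1ℚ + q * n) * w ≡ r * (γ - w)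
      eq = solve-∀ ℚ-ring
      μ-wt≡ : μ - wt x ≡ r * (γ - wt x)
      μ-wt≡ = trans (cong₂ _-_ (trans (avg.≗-cong sampled≡) (cong (r *_) sum≡)) (sym (trans (cong (_* wt x) r*N≡1) (*-identityˡ (wt x)))))
        (eq r (fromℕ q) (wt x) (fromℕ n) γ)
      neg : ∀ r s → r * (- s) ≡ - (r * s)
      neg = solve-∀ ℚ-ring
      eq₁ : ∀ γ w → 1ℚ - (γ - w) ≡ (1ℚ - γ) + w
      eq₁ = solve-∀ ℚ-ring
      eq₂ : ∀ γ w → 1ℚ - (- (γ - w)) ≡ (1ℚ - w) + γ
      eq₂ = solve-∀ ℚ-ring
      γ-w≤1 : γ - wt x ≤ 1ℚ
      γ-w≤1 = ≤-by (eq₁ γ (wt x)) (0≤+ (p≤q⇒0≤q-p (bit≤1ℚ (lookup x ((M ℕ.+ 0) mod n)))) (0≤wt x))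
      w-γ≤1 : - (γ - wt x) ≤ 1ℚ
      w-γ≤1 = ≤-by (eq₂ γ (wt x)) (0≤+ (p≤q⇒0≤q-p (wt≤1 x)) (0≤bit (lookup x ((M ℕ.+ 0) mod n))))

  -- The protocol

  Pr[accept]≤1 : ∀ {n} s (x : Vec Bool n) V P → Pr[accept] s x V P ≤ 1ℚ
  Pr[accept]≤1 []            x V P = 𝔼-≤ x V (λ { false → 0≤fromℕ 1 ; true → ≤-refl })
  Pr[accept]≤1 ((a , b) ∷ s) x V P = 𝔼-≤ x V (λ (m , V′) → 𝔼-≤ x (P m) (λ (r , P′) → Pr[accept]≤1 s x (V′ r) P′))

  0≤Pr[accept] : ∀ {n} s (x : Vec Bool n) V P → 0ℚ ≤ Pr[accept] s x V P
  0≤Pr[accept] []            x V P = 𝔼-≥ x V (λ { false → ≤-refl ; true → 0≤fromℕ 1 })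
  0≤Pr[accept] ((a , b) ∷ s) x V P = 𝔼-≥ x V (λ (m , V′) → 𝔼-≥ x (P m) (λ (r , P′) → 0≤Pr[accept] s x (V′ r) P′))

  queryCost-toss³ : ∀ {n} (x : Vec Bool n) v p a b s k (V : (i j l : Fin (suc k)) → Verifier n ((a , b) ∷ s)) P {B} →
    (∀ i j l → queryCost v p ((a , b) ∷ s) x (V i j l) P ℕ.≤ B) →
    queryCost v p ((a , b) ∷ s) x (toss k λ i → toss k λ j → toss k λ l → V i j l) P ℕ.≤ B
  queryCost-toss³ x v p a b s k V P h =
    ⊔-lub-foldr (λ i → queryCost v p ((a , b) ∷ s) x (toss k λ j → toss k λ l → V i j l) P) λ i →
    ⊔-lub-foldr (λ j → queryCost v p ((a , b) ∷ s) x (toss k λ l → V i j l) P) λ j →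
    ⊔-lub-foldr (λ l → queryCost v p ((a , b) ∷ s) x (V i j l) P) (h i j)

  provided : ∀ {n s} {A B : Set} → Dec A → Dec B → Verifier n s → Verifier n s
  provided {s = s} (yes _) (yes _) V = V
  provided {s = s} _       _       V = reject s

  provided-elim : ∀ {n s} {A B : Set} (P : Verifier n s → Set) (a? : Dec A) (b? : Dec B) {V} →
    P (reject s) → (A → B → P V) → P (provided a? b? V)
  provided-elim P (yes a) (yes b) r f = f a b
  provided-elim P (yes _) (no _)  r f = r
  provided-elim P (no _)  _       r f = r

  provided-yes : ∀ {n s} {A B : Set} (P : Verifier n s → Set) (a? : Dec A) (b? : Dec B) {V} →
    A → B → P V → P (provided a? b? V)
  provided-yes P (yes _) (yes _) a b p = p
  provided-yes P (yes _) (no ¬b) a b p = contradiction b ¬b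
  provided-yes P (no ¬a) _       a b p = contradiction a ¬a

  triple : ℕ → ℕ → ℕ → Fin 3 → ℕ
  triple a b c zero             = a
  triple a b c (suc zero)       = b
  triple a b c (suc (suc zero)) = c

  module Protocol (k h : ℕ) (cut tolerance : ℚ) (seedBits : ℕ) where
    d b : ℕ
    d = h ℕ.+ h
    -- The announced weight ranges from 0 to `2 ^ d` inclusive, one value too many for `d` bits.
    b = suc d

    shape : Shape
    shape = (3 ℕ.* seedBits , b) ∷ treeShape k b d

    module _ (n : ℕ) .{{_ : NonZero n}} (σ : Fin (suc n)) where

      σ/n : ℚ
      σ/n = ℤ.+ toℕ σ / n

      plausible? : ∀ τ → Dec (∣ ½^ d * fromℕ τ - σ/n ∣ ≤ cut + (tolerance + tolerance))
      plausible? τ = ∣ ½^ d * fromℕ τ - σ/n ∣ ≤? (cut + (tolerance + tolerance))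

      verifyClaim : ℕ → (Vec Bool d → Fin n) → Verifier n (treeShape k b d)
      -- The reply has room for values above `2 ^ d`. Refusing them establishes at the root the
      -- bound on claims that the clamping then preserves at every level.
      verifyClaim τ ι = provided (τ ℕ.≤? 2 ^ d) (plausible? τ) (treeVerifier k b d (λ _ → τ) (λ _ → ι))

      announce : (i j l : Fin (suc (period n h))) → Verifier n shape
      announce i j l = return (pack 3 seedBits (triple (toℕ i) (toℕ j) (toℕ l)) ,
        λ r → verifyClaim (fromBits r) (point n h (toℕ i) (toℕ j) (toℕ l)))

      verifier : Verifier n shape
      verifier = toss (period n h) λ i → toss (period n h) λ j → toss (period n h) λ l → announce i j l

      seeded : Vec Bool (3 ℕ.* seedBits) → Vec Bool d → Fin n
      seeded m = point n h (unpack 3 seedBits m zero) (unpack 3 seedBits m (suc zero)) (unpack 3 seedBits m (suc (suc zero)))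

      honest : Prover n shape
      honest m = readAll d (seeded m)
        (λ y → return (toBits b (weight d y) , treeProver k b d (λ _ → y)))

      queryCost-verifier : ∀ x P → verifierQueries shape x verifier P ℕ.≤ k
      queryCost-verifier x P = queryCost-toss³ x 1 0 (3 ℕ.* seedBits) b (treeShape k b d) (period n h) announce P λ i j l →
        worst-free x (P (pack 3 seedBits (triple (toℕ i) (toℕ j) (toℕ l))))
          (λ (r , P′) → bound (fromBits r) (point n h (toℕ i) (toℕ j) (toℕ l)) P′)
        where
        bound : ∀ τ ι P → queryCost 1 0 (treeShape k b d) x (verifyClaim τ ι) P ℕ.≤ k
        bound τ ι P = provided-elim (λ V → queryCost 1 0 (treeShape k b d) x V P ℕ.≤ k) (τ ℕ.≤? 2 ^ d) (plausible? τ)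
          (ℕ.≤-trans (queryCost-reject x (treeShape k b d) P) z≤n)
          (λ _ _ → queryCost-treeVerifier x k b d (λ _ → τ) (λ _ → ι) P)

      queryCost-honest : ∀ x → proverQueries shape x verifier honest ℕ.≤ 2 ^ d ℕ.+ 0
      queryCost-honest x = queryCost-toss³ x 0 1 (3 ℕ.* seedBits) b (treeShape k b d) (period n h) announce honest λ i j l →
        let m = pack 3 seedBits (triple (toℕ i) (toℕ j) (toℕ l)) in
        worst-readAll x d (seeded m) (λ y → return (toBits b (weight d y) , treeProver k b d (λ _ → y)))
          (λ y → queryCost-treeProver x k b d (verifyClaim (fromBits (toBits b (weight d y))) (point n h (toℕ i) (toℕ j) (toℕ l))) (λ _ → y))

      -- Soundness and completeness of the whole protocol

      module Correct (D-1 : ℕ) (k≡10D : k ≡ 10 ℕ.* suc D-1) (tolerance≡1/8D : tolerance ≡ 1/suc (7 ℕ.+ 8 ℕ.* D-1))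
        (32D≤2^h : 32 ℕ.* suc D-1 ℕ.≤ 2 ^ h) (N≤ : suc (period n h) ℕ.≤ 2 ^ seedBits) (x : Vec Bool n) where
        open Sampling x h hiding (d)
        module E = IsExpectation seedExpectation

        D : ℕ
        D = suc D-1

        -- In units of u = 1/(8D): sampling shifts the weight by at most 2, the test
        -- allows 2 beyond cut, and false claims deviate by at least cut + 8, so a
        -- false announcement that passes the test is off by at least 4.
        u L : ℚ
        u = tolerance
        L = fromℕ (8 ℕ.* D)

        private
          8D≡ : 8 ℕ.* D ≡ suc (7 ℕ.+ 8 ℕ.* D-1)
          8D≡ = ℕ.*-suc 8 D-1

          u*L≡1 : u * L ≡ 1ℚ
          u*L≡1 = trans (cong₂ (λ u z → u * fromℕ z) tolerance≡1/8D 8D≡) (1/suc-* (7 ℕ.+ 8 ℕ.* D-1))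

          0≤u : 0ℚ ≤ u
          0≤u = subst (0ℚ ≤_) (sym tolerance≡1/8D) (0≤1/suc (7 ℕ.+ 8 ℕ.* D-1))

          -- Nonnegative, and at least 1 as soon as the sampling error exceeds `u`. Adding or
          -- subtracting it pointwise therefore pays for all bad seeds, which is Markov's inequality
          -- without events. As `L * ½^ h` is at most 8D/(32D), its mean is at most 1/16.
          loss : Seed → ℚ
          loss ω = (L * error ω) * (L * error ω)

          0≤loss : ∀ ω → 0ℚ ≤ loss ω
          0≤loss ω = 0≤sq (L * error ω)

          ¼ : ℚ
          ¼ = ℤ.+ 1 / 4

          L½^h≤¼ : L * ½^ h ≤ ¼
          L½^h≤¼ = subst₂ _≤_ (eq L (½^ h)) (trans (cong (¼ *_) (trans (*-comm (fromℕ (2 ^ h)) (½^ h)) (½^-inverse h))) (*-identityʳ ¼))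
            (*-monoˡ {¼} (0≤1/suc 3) (*-monoʳ (0≤½^ h) (subst (_≤ fromℕ (2 ^ h)) (fromℕ-* 4 (8 ℕ.* D))
              (fromℕ-mono (subst (ℕ._≤ 2 ^ h) (ℕ.*-assoc 4 8 D) 32D≤2^h)))))
            where
            eq : ∀ L h → ¼ * (fromℕ 4 * L * h) ≡ L * h
            eq = solve-∀ ℚ-ring

          Eloss : 𝔼seed loss ≤ ¼ * ¼
          Eloss = ≤-trans (chebyshev L) (*-mono (0≤* (0≤fromℕ (8 ℕ.* D)) (0≤½^ h)) (0≤1/suc 3) L½^h≤¼ L½^h≤¼)

          estimate : Seed → ℚ
          estimate ω = ½^ d * fromℕ (sampleWeight ω)

          -- One unit `u` is the random error, the other the bias, which is at most `1/N` and hence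
          -- far below `u` since `N > 2 ^ h ≥ 32 D`.
          typical : ∀ ω → ∣ L * error ω ∣ ≤ 1ℚ → ∣ estimate ω - wt x ∣ ≤ u + u
          typical ω small = ≤-trans (∣-∣-triangle (estimate ω) μ (wt x)) (+-mono-≤ ∣error∣≤u
            (≤-trans bias (subst (1/suc M ≤_) (sym tolerance≡1/8D) (1/suc-antitone (ℕ.s≤s⁻¹ (subst (ℕ._≤ suc M) 8D≡ 8D≤))))))
            where
            8D≤ : 8 ℕ.* D ℕ.≤ suc M
            8D≤ = ℕ.≤-trans (ℕ.*-monoˡ-≤ D (ℕ.m≤m+n 8 24)) (ℕ.≤-trans 32D≤2^h (ℕ.m≤n⇒m≤1+n (2^h≤period n h)))
            ∣error∣≤u : ∣ error ω ∣ ≤ u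
            ∣error∣≤u = subst₂ _≤_
              (trans (cong (_* ∣ L * error ω ∣) (sym (0≤p⇒∣p∣≡p 0≤u))) (trans (sym (∣p*q∣≡∣p∣*∣q∣ u (L * error ω)))
                (cong ∣_∣ (trans (sym (*-assoc u L (error ω))) (trans (cong (_* error ω) u*L≡1) (*-identityˡ (error ω)))))))
              (*-identityʳ u) (*-monoˡ 0≤u small)

          atypical : ∀ ω → 1ℚ ≤ ∣ L * error ω ∣ → 1ℚ ≤ loss ω
          atypical ω large = ≤-trans (*-mono (0≤fromℕ 1) (0≤∣p∣ (L * error ω)) large large)
            (≤-reflexive (trans (sym (∣p*q∣≡∣p∣*∣q∣ (L * error ω) (L * error ω))) (0≤p⇒∣p∣≡p (0≤loss ω))))

        pointOf : Seed → Vec Bool d → Fin n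
        pointOf (i , j , l) = point n h (toℕ i) (toℕ j) (toℕ l)

        message : Seed → Vec Bool (3 ℕ.* seedBits)
        message (i , j , l) = pack 3 seedBits (triple (toℕ i) (toℕ j) (toℕ l))

        conditional : Prover n shape → Seed → ℚ
        conditional P ω = 𝔼 x (P (message ω)) (λ (r , P′) →
          Pr[accept] (treeShape k b d) x (verifyClaim (fromBits r) (pointOf ω)) P′)

        module _ (sound : cut + 1/suc D-1 ≤ deviation x σ) where
          private
            far : ∀ ω τ → ∣ estimate ω - wt x ∣ ≤ u + u → ∣ ½^ d * fromℕ τ - σ/n ∣ ≤ cut + (u + u) →
                  fromℕ 4 * u ≤ ½^ d * fromℕ ℕ.∣ τ - sampleWeight ω ∣
            far ω τ close plausible = ≤-trans
              (≤-by (eq cut u (deviation x σ) (∣ e - w ∣) (∣ t - s ∣) (∣ t - e ∣))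
                (0≤+ (p≤q⇒0≤q-p triangle) (0≤+ (p≤q⇒0≤q-p close) (0≤+ (p≤q⇒0≤q-p plausible) (p≤q⇒0≤q-p sound′)))))
              (∣p∣≤ (subst (_≤ ½^ d * fromℕ δ) (distrib (½^ d) (fromℕ τ) (fromℕ W)) (*-monoˡ (0≤½^ d) τ-W≤δ))
                    (subst (_≤ ½^ d * fromℕ δ) (distrib′ (½^ d) (fromℕ τ) (fromℕ W)) (*-monoˡ (0≤½^ d) W-τ≤δ)))
              where
              w = wt x
              s = σ/n
              t = ½^ d * fromℕ τ
              e = estimate ω
              W = sampleWeight ω
              δ = ℕ.∣ τ - W ∣
              1/D≡8u : 1/suc D-1 ≡ fromℕ 8 * u
              1/D≡8u = sym (trans (cong (fromℕ 8 *_) tolerance≡1/8D) (trans (/-* 8 0 1 (7 ℕ.+ 8 ℕ.* D-1)) (/-≡ 8 (7 ℕ.+ 8 ℕ.* D-1 ℕ.+ 0) 1 D-1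
                (trans 8D≡ (sym (trans (ℕ.*-identityˡ (suc (7 ℕ.+ 8 ℕ.* D-1 ℕ.+ 0))) (cong suc (ℕ.+-identityʳ (7 ℕ.+ 8 ℕ.* D-1)))))))))
              sound′ : cut + fromℕ 8 * u ≤ deviation x σ
              sound′ = subst (λ z → cut + z ≤ deviation x σ) 1/D≡8u sound
              triangle : deviation x σ ≤ ∣ e - w ∣ + (∣ t - e ∣ + ∣ t - s ∣)
              triangle = ≤-trans (∣-∣-triangle w e s) (+-mono-≤ (≤-reflexive (∣p-q∣≡∣q-p∣ w e))
                (≤-trans (∣-∣-triangle e t s) (+-monoˡ-≤ ∣ t - s ∣ (≤-reflexive (∣p-q∣≡∣q-p∣ e t)))))
              eq : ∀ c u dev a b f → f - fromℕ 4 * u ≡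
                ((a + (f + b)) - dev) + (((u + u) - a) + (((c + (u + u)) - b) + (dev - (c + fromℕ 8 * u))))
              eq = solve-∀ ℚ-ring
              distrib : ∀ h a b → h * (a - b) ≡ h * a - h * b
              distrib = solve-∀ ℚ-ring
              distrib′ : ∀ h a b → h * (b - a) ≡ - (h * a - h * b)
              distrib′ = solve-∀ ℚ-ring
              cancel : ∀ a b → (a + b) - a ≡ b
              cancel = solve-∀ ℚ-ring
              τ-W≤δ : fromℕ τ - fromℕ W ≤ fromℕ δ
              τ-W≤δ = subst (fromℕ τ - fromℕ W ≤_) (trans (cong (_- fromℕ W) (fromℕ-+ W δ)) (cancel (fromℕ W) (fromℕ δ)))
                (+-monoˡ-≤ (- fromℕ W) (fromℕ-mono (ℕ.m≤n+∣m-n∣ τ W)))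
              W-τ≤δ : fromℕ W - fromℕ τ ≤ fromℕ δ
              W-τ≤δ = subst (fromℕ W - fromℕ τ ≤_) (trans (cong (_- fromℕ τ) (fromℕ-+ τ δ)) (cancel (fromℕ τ) (fromℕ δ)))
                (+-monoˡ-≤ (- fromℕ τ) (fromℕ-mono (ℕ.m≤n+∣n-m∣ W τ)))

            score+4u≤1 : ∀ τ W → τ ℕ.≤ 2 ^ d → W ℕ.≤ 2 ^ d → fromℕ 4 * u ≤ ½^ d * fromℕ ℕ.∣ τ - W ∣ →
                         score d τ W + fromℕ 4 * u ≤ 1ℚ
            score+4u≤1 τ W τ≤ W≤ h₄ = begin
              fromℕ (2 ^ d ∸ δ) * ½^ d + fromℕ 4 * u         ≤⟨ +-monoʳ-≤ (fromℕ (2 ^ d ∸ δ) * ½^ d) h₄ ⟩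
              fromℕ (2 ^ d ∸ δ) * ½^ d + ½^ d * fromℕ δ      ≡⟨ eq (fromℕ (2 ^ d ∸ δ)) (½^ d) (fromℕ δ) ⟩
              ½^ d * (fromℕ (2 ^ d ∸ δ) + fromℕ δ)           ≡⟨ cong (½^ d *_) (fromℕ-+ (2 ^ d ∸ δ) δ) ⟨
              ½^ d * fromℕ (2 ^ d ∸ δ ℕ.+ δ)                 ≡⟨ cong (λ z → ½^ d * fromℕ z) (ℕ.m∸n+n≡m (ℕ.≤-trans (ℕ.∣m-n∣≤m⊔n τ W) (ℕ.⊔-lub τ≤ W≤))) ⟩
              ½^ d * fromℕ (2 ^ d)                           ≡⟨ ½^-inverse d ⟩
              1ℚ                                             ∎
              where
              open ≤-Reasoning
              δ = ℕ.∣ τ - W ∣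
              eq : ∀ a h b → a * h + h * b ≡ h * (a + b)
              eq = solve-∀ ℚ-ring

            ⅙ : ℚ
            ⅙ = ℤ.+ 1 / 6

            -- A path catches the lie with probability at least `4 u`, and
            -- `k * 4u = 10D * 4/(8D) = 5`, so Bernoulli's inequality yields `1/(1 + 5)`. Together
            -- with the mean loss 1/16 this stays below 1/3.
            ∏≤⅙ : ∀ q → 0ℚ ≤ q → q + fromℕ 4 * u ≤ 1ℚ → ∏ k (λ _ → q) ≤ ⅙
            ∏≤⅙ q 0≤q h₄ = subst₂ _≤_ (trans (cong (⅙ *_) (cong (p *_) 1+kγ≡6)) (eq p)) (*-identityʳ ⅙)
              (*-monoˡ {⅙} (0≤1/suc 5) (∏-bernoulli k 0≤q (0≤* (0≤fromℕ 4) 0≤u) h₄))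
              where
              p = ∏ k (λ _ → q)
              eq : ∀ p → ⅙ * (p * fromℕ 6) ≡ p
              eq = solve-∀ ℚ-ring
              eq′ : ∀ D u → 1ℚ + fromℕ 10 * D * (fromℕ 4 * u) ≡ 1ℚ + fromℕ 5 * (u * (fromℕ 8 * D))
              eq′ = solve-∀ ℚ-ring
              1+kγ≡6 : 1ℚ + fromℕ k * (fromℕ 4 * u) ≡ fromℕ 6
              1+kγ≡6 = trans (cong (λ z → 1ℚ + z * (fromℕ 4 * u)) (trans (cong fromℕ k≡10D) (fromℕ-* 10 D))) (trans (eq′ (fromℕ D) u)
                (cong (λ z → 1ℚ + fromℕ 5 * z) (trans (cong (u *_) (sym (fromℕ-* 8 D))) u*L≡1)))

            caught : ∀ ω → ∣ L * error ω ∣ ≤ 1ℚ → ∀ τ P →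
              Pr[accept] (treeShape k b d) x (verifyClaim τ (pointOf ω)) P ≤ ⅙
            caught ω small τ P = provided-elim (λ V → Pr[accept] (treeShape k b d) x V P ≤ ⅙) (τ ℕ.≤? 2 ^ d) (plausible? τ)
              (≤-trans (𝔼-reject x (treeShape k b d) P) (0≤1/suc 5))
              (λ τ≤ plausible → ≤-trans (treeVerifier-sound x k b d (λ _ → τ) (λ _ → pointOf ω) (λ _ → τ≤) P)
                (∏≤⅙ (score d τ (sampleWeight ω)) (0≤score d τ (sampleWeight ω))
                  (score+4u≤1 τ (sampleWeight ω) τ≤ (weight≤2^ d (λ v → lookup x (pointOf ω v)))
                    (far ω τ (typical ω small) plausible))))

            conditional≤ : ∀ P ω → conditional P ω ≤ ⅙ + loss ω
            conditional≤ P ω = [ (λ small → ≤-trans (𝔼-≤ x (P (message ω)) (λ (r , P′) → caught ω small (fromBits r) P′))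
                   (subst (_≤ ⅙ + loss ω) (+-identityʳ ⅙) (+-monoʳ-≤ ⅙ (0≤loss ω))))
              , (λ large → ≤-trans (𝔼-≤ x (P (message ω)) (λ (r , P′) → Pr[accept]≤1 (treeShape k b d) x (verifyClaim (fromBits r) (pointOf ω)) P′))
                   (≤-trans (atypical ω large) (subst (_≤ ⅙ + loss ω) (+-identityˡ (loss ω)) (+-monoˡ-≤ (loss ω) (0≤1/suc 5)))))
              ]′ (≤-total (∣ L * error ω ∣) 1ℚ)

          soundness : ∀ P → Pr[accept] shape x verifier P ≤ ℤ.+ 1 / 3
          soundness P = begin
            𝔼seed (conditional P)           ≤⟨ E.mono (conditional≤ P) ⟩
            𝔼seed (λ ω → ⅙ + loss ω)        ≡⟨ E.+-homo (λ _ → ⅙) loss ⟩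
            𝔼seed (λ _ → ⅙) + 𝔼seed loss    ≡⟨ cong (_+ 𝔼seed loss) (E.const ⅙) ⟩
            ⅙ + 𝔼seed loss                  ≤⟨ +-monoʳ-≤ ⅙ Eloss ⟩
            ⅙ + ¼ * ¼                       ≤⟨ from-yes ((⅙ + ¼ * ¼) ≤? (ℤ.+ 1 / 3)) ⟩
            ℤ.+ 1 / 3                         ∎
            where open ≤-Reasoning

        module _ (close : deviation x σ ≤ cut) where
          private
            convinced : ∀ ω → ∣ L * error ω ∣ ≤ 1ℚ → ∀ y → (∀ v → y v ≡ lookup x (pointOf ω v)) →
              ∀ τ → τ ≡ weight d y →
              1ℚ ≤ Pr[accept] (treeShape k b d) x (verifyClaim τ (pointOf ω)) (treeProver k b d (λ _ → y))
            convinced ω small y y≡ τ τ≡ = provided-yes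
              (λ V → 1ℚ ≤ Pr[accept] (treeShape k b d) x V (treeProver k b d (λ _ → y))) (τ ℕ.≤? 2 ^ d) (plausible? τ)
              (subst (ℕ._≤ 2 ^ d) (sym τ≡) (weight≤2^ d y)) plausible
              (treeVerifier-complete x k b d (λ _ → τ) (λ _ → pointOf ω) (λ _ → y) (ℕ.n≤1+n d)
                (λ _ → trans τ≡ (weight-cong d y≡)) (λ _ → y≡))
              where
              t≡e : ½^ d * fromℕ τ ≡ estimate ω
              t≡e = cong (λ z → ½^ d * fromℕ z) (trans τ≡ (weight-cong d y≡))
              plausible : ∣ ½^ d * fromℕ τ - σ/n ∣ ≤ cut + (u + u)
              plausible = subst (λ t → ∣ t - σ/n ∣ ≤ cut + (u + u)) (sym t≡e)
                (≤-trans (∣-∣-triangle (estimate ω) (wt x) σ/n)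
                  (subst (∣ estimate ω - wt x ∣ + deviation x σ ≤_) (+-comm (u + u) cut) (+-mono-≤ (typical ω small) close)))

            unpacked : ∀ ω i → unpack 3 seedBits (message ω) i ≡ triple (toℕ (proj₁ ω)) (toℕ (proj₁ (proj₂ ω))) (toℕ (proj₂ (proj₂ ω))) i
            unpacked ω@(i , j , l) t = unpack-pack 3 seedBits (triple (toℕ i) (toℕ j) (toℕ l)) t (fits t)
              where
              fits : ∀ t → triple (toℕ i) (toℕ j) (toℕ l) t ℕ.< 2 ^ seedBits
              fits zero             = ℕ.<-≤-trans (Fin.toℕ<n i) N≤
              fits (suc zero)       = ℕ.<-≤-trans (Fin.toℕ<n j) N≤
              fits (suc (suc zero)) = ℕ.<-≤-trans (Fin.toℕ<n l) N≤

            point≡ : ∀ ω v → seeded (message ω) v ≡ pointOf ω v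
            point≡ ω v = trans (cong (λ a → point n h a (unpack 3 seedBits (message ω) (suc zero)) (unpack 3 seedBits (message ω) (suc (suc zero))) v) (unpacked ω zero))
              (cong₂ (λ b c → point n h (toℕ (proj₁ ω)) b c v) (unpacked ω (suc zero)) (unpacked ω (suc (suc zero))))

            -- On a typical sample the honest prover convinces the verifier with certainty, so bad
            -- seeds are the only source of completeness error.
            conditional≥ : ∀ ω → 1ℚ - loss ω ≤ conditional honest ω
            conditional≥ ω = [ (λ small → ≤-trans (subst (1ℚ - loss ω ≤_) (+-identityʳ 1ℚ) (+-monoʳ-≤ 1ℚ (neg-antimono-≤ (0≤loss ω))))
                  (𝔼-readAll-≥ x d (seeded (message ω)) (λ y → return (toBits b (weight d y) , treeProver k b d (λ _ → y))) (λ y y≡ → convinced ω small y (λ v → trans (y≡ v) (cong (lookup x) (point≡ ω v)))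
                    (fromBits (toBits b (weight d y)))
                    (fromBits-toBits b (weight d y) (ℕ.≤-<-trans (weight≤2^ d y) (ℕ.^-monoʳ-< 2 (s≤s (s≤s z≤n)) (ℕ.n<1+n d)))))))
              , (λ large → ≤-trans (subst (1ℚ - loss ω ≤_) (+-inverseʳ 1ℚ) (+-monoʳ-≤ 1ℚ (neg-antimono-≤ (atypical ω large))))
                  (𝔼-≥ x (honest (message ω)) (λ (r , P′) → 0≤Pr[accept] (treeShape k b d) x (verifyClaim (fromBits r) (pointOf ω)) P′)))
              ]′ (≤-total (∣ L * error ω ∣) 1ℚ)

          completeness : ℤ.+ 2 / 3 ≤ Pr[accept] shape x verifier honest
          completeness = begin
            ℤ.+ 2 / 3                             ≤⟨ from-yes ((ℤ.+ 2 / 3) ≤? (1ℚ - ¼ * ¼)) ⟩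
            1ℚ - ¼ * ¼                          ≤⟨ +-monoʳ-≤ 1ℚ (neg-antimono-≤ Eloss) ⟩
            1ℚ - 𝔼seed loss                     ≡⟨ cong (1ℚ +_) (eq (𝔼seed loss)) ⟩
            1ℚ + - 1ℚ * 𝔼seed loss              ≡⟨ cong₂ _+_ (E.const 1ℚ) (E.*-homo (- 1ℚ) loss) ⟨
            𝔼seed (λ _ → 1ℚ) + 𝔼seed (λ ω → - 1ℚ * loss ω) ≡⟨ E.+-homo (λ _ → 1ℚ) (λ ω → - 1ℚ * loss ω) ⟨
            𝔼seed (λ ω → 1ℚ + - 1ℚ * loss ω)    ≡⟨ E.≗-cong (λ ω → cong (1ℚ +_) (sym (eq (loss ω)))) ⟩
            𝔼seed (λ ω → 1ℚ - loss ω)           ≤⟨ E.mono conditional≥ ⟩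
            𝔼seed (conditional honest)          ∎
            where
            open ≤-Reasoning
            eq : ∀ z → - z ≡ - 1ℚ * z
            eq = solve-∀ ℚ-ring

open Verification
open import Data.Nat using (ℕ; NonZero; _+_; _*_; _^_; _≤_; _≤?_)

-- Complexity bounds

-- The binary logarithm rounded up, by a recursion whose induction yields both `m ≤ 2 ^ clog m` and,
-- for positive `m`, `2 ^ clog m ≤ 2 m`: the first for correctness, the second for the costs.
clog : ℕ → ℕ
clog zero = 0
clog (suc m) with suc m ≤? 2 ^ clog m
... | yes _ = clog m
... | no  _ = suc (clog m)

m≤2^clog : ∀ m → m ≤ 2 ^ clog m
m≤2^clog zero = z≤n
m≤2^clog (suc m) with suc m ≤? 2 ^ clog m
... | yes p = p
... | no  _ = ℕ.+-mono-≤ (ℕ.m^n>0 2 (clog m)) (ℕ.≤-trans (m≤2^clog m) (ℕ.m≤m+n (2 ^ clog m) 0))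

2^clog≤2* : ∀ m → 2 ^ clog (suc m) ≤ 2 * suc m
2^clog≤2* m with suc m ≤? 2 ^ clog m
2^clog≤2* zero    | yes _ = s≤s z≤n
2^clog≤2* (suc m) | yes _ = ℕ.≤-trans (2^clog≤2* m) (ℕ.*-monoʳ-≤ 2 (ℕ.n≤1+n (suc m)))
2^clog≤2* m       | no ¬p = ℕ.*-monoʳ-≤ 2 (ℕ.<⇒≤ (ℕ.≰⇒> ¬p))

clog≤1+⌈log₂⌉ : ∀ m .{{_ : NonZero m}} → clog m ≤ 1 + ⌈log₂ m ⌉
clog≤1+⌈log₂⌉ (suc m) = subst₂ _≤_ (⌈log₂2^n⌉≡n (clog (suc m))) (⌈log₂2*n⌉≡1+⌈log₂n⌉ (suc m)) (⌈log₂⌉-mono-≤ (2^clog≤2* m))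

⌈log₂2^s*n⌉≡s+⌈log₂n⌉ : ∀ s n .{{_ : NonZero n}} → ⌈log₂ (2 ^ s * n) ⌉ ≡ s + ⌈log₂ n ⌉
⌈log₂2^s*n⌉≡s+⌈log₂n⌉ zero    n = cong ⌈log₂_⌉ (ℕ.*-identityˡ n)
⌈log₂2^s*n⌉≡s+⌈log₂n⌉ (suc s) n = trans (cong ⌈log₂_⌉ (ℕ.*-assoc 2 (2 ^ s) n))
  (trans (⌈log₂2*n⌉≡1+⌈log₂n⌉ (2 ^ s * n) {{ℕ.m*n≢0 (2 ^ s) n {{ℕ.m^n≢0 2 s}}}}) (cong suc (⌈log₂2^s*n⌉≡s+⌈log₂n⌉ s n)))

n!≤n^n : ∀ n → n ! ≤ n ^ n
n!≤n^n zero    = ℕ.≤-refl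
n!≤n^n (suc n) = ℕ.*-monoʳ-≤ (suc n) (ℕ.≤-trans (n!≤n^n n) (ℕ.^-monoˡ-≤ n (ℕ.n≤1+n n)))

-- The crude bound `m ! ≤ m ^ m` with `m = 2 ^ h` makes the factorial cost `h * 2 ^ h` bits, which
-- is O(t log t), while `n` contributes its own logarithm additively.
clog-period : ∀ n .{{_ : NonZero n}} h → clog (suc (period n h)) ≤ 2 + (h * 2 ^ h + ⌈log₂ n ⌉)
clog-period n h = ℕ.≤-trans (clog≤1+⌈log₂⌉ (suc (period n h))) (s≤s
  (subst (⌈log₂ suc (period n h) ⌉ ≤_) (⌈log₂2^s*n⌉≡s+⌈log₂n⌉ (suc (h * m)) n) (⌈log₂⌉-mono-≤ bound)))
  where
  open ℕ.≤-Reasoning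
  m = 2 ^ h
  m!≤ : m ! ≤ 2 ^ (h * m)
  m!≤ = subst (m ! ≤_) (ℕ.^-*-assoc 2 h m) (n!≤n^n m)
  bound : suc (m ! * n) ≤ 2 ^ suc (h * m) * n
  bound = begin
    1 + m ! * n                 ≤⟨ ℕ.+-monoˡ-≤ (m ! * n) (ℕ.≤-trans (ℕ.m^n>0 2 h) (2^h≤period n h)) ⟩
    m ! * n + m ! * n           ≡⟨ eq (m !) n ⟩
    2 * m ! * n                 ≤⟨ ℕ.*-monoˡ-≤ n (ℕ.*-monoʳ-≤ 2 m!≤) ⟩
    2 ^ suc (h * m) * n         ∎
    where
    eq : ∀ f n → f * n + f * n ≡ 2 * f * n
    eq = ℕ-Ring.solve-∀

length-treeShape : ∀ k b e → length (treeShape k b e) ≡ 2 * e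
length-treeShape k b zero    = refl
length-treeShape k b (suc e) = trans (cong (2 +_) (length-treeShape k b e)) (sym (ℕ.*-suc 2 e))

communication-treeShape : ∀ k b e → sum (map (uncurry _+_) (treeShape k b e)) ≡ e * (k * b + k)
communication-treeShape k b zero    = refl
communication-treeShape k b (suc e) = trans (cong (λ z → k * b + ((k + 0) + z)) (communication-treeShape k b e)) (eq (k * b) k (e * (k * b + k)))
  where
  eq : ∀ kb k z → kb + ((k + 0) + z) ≡ kb + k + z
  eq = ℕ-Ring.solve-∀

32*m≤2^[5+clog] : ∀ m → 32 * m ≤ 2 ^ (5 + clog m)
32*m≤2^[5+clog] m = subst (32 * m ≤_) (sym (ℕ.^-distribˡ-+-* 2 5 (clog m))) (ℕ.*-monoʳ-≤ 32 (m≤2^clog m))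

2^[5+clog]≤448* : ∀ m t → suc m ≤ 7 * t → 2 ^ (5 + clog (suc m)) ≤ 448 * t
2^[5+clog]≤448* m t m<7t = begin
  2 ^ (5 + clog (suc m))     ≡⟨ ℕ.^-distribˡ-+-* 2 5 (clog (suc m)) ⟩
  32 * 2 ^ clog (suc m)      ≤⟨ ℕ.*-monoʳ-≤ 32 (2^clog≤2* m) ⟩
  32 * (2 * suc m)           ≤⟨ ℕ.*-monoʳ-≤ 32 (ℕ.*-monoʳ-≤ 2 m<7t) ⟩
  32 * (2 * (7 * t))         ≡⟨ assoc 32 2 7 t ⟩
  448 * t                    ∎
  where
  open ℕ.≤-Reasoning
  assoc : ∀ a b c t → a * (b * (c * t)) ≡ a * b * c * t
  assoc = ℕ-Ring.solve-∀

5+clog≤9* : ∀ m t .{{_ : NonZero m}} .{{_ : NonZero t}} → m ≤ 7 * t → 5 + clog m ≤ 9 * (1 + ⌈log₂ t ⌉)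
5+clog≤9* m t m≤7t = begin
  5 + clog m                 ≤⟨ ℕ.+-monoʳ-≤ 5 (clog≤1+⌈log₂⌉ m) ⟩
  6 + ⌈log₂ m ⌉              ≤⟨ ℕ.+-monoʳ-≤ 6 (⌈log₂⌉-mono-≤ (ℕ.≤-trans m≤7t (ℕ.*-monoˡ-≤ t (ℕ.n≤1+n 7)))) ⟩
  6 + ⌈log₂ (2 ^ 3 * t) ⌉    ≡⟨ cong (6 +_) (⌈log₂2^s*n⌉≡s+⌈log₂n⌉ 3 t) ⟩
  9 + ⌈log₂ t ⌉              ≤⟨ ℕ.+-monoʳ-≤ 9 (ℕ.m≤n*m ⌈log₂ t ⌉ 9) ⟩
  9 + 9 * ⌈log₂ t ⌉          ≡⟨ ℕ.*-suc 9 ⌈log₂ t ⌉ ⟨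
  9 * (1 + ⌈log₂ t ⌉)        ∎
  where open ℕ.≤-Reasoning

scaled-product : ∀ a b u v → (a * u) * (b * v) ≡ (a * b) * (u * v)
scaled-product = ℕ-Ring.solve-∀

-- Costs in terms of an upper bound `t` on 1/g

module Costs (k h t : ℕ) .{{_ : NonZero t}} (k≤70t : k ≤ 70 * t)
             (h≤9ℓ : h ≤ 9 * (1 + ⌈log₂ t ⌉)) (2^h≤448t : 2 ^ h ≤ 448 * t) where
  ℓ : ℕ
  ℓ = 1 + ⌈log₂ t ⌉

  honest≤ : 2 ^ (h + h) + 0 ≤ 448 * 448 * (t * t)
  honest≤ = begin
    2 ^ (h + h) + 0            ≡⟨ trans (ℕ.+-identityʳ (2 ^ (h + h))) (ℕ.^-distribˡ-+-* 2 h h) ⟩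
    2 ^ h * 2 ^ h              ≤⟨ ℕ.*-mono-≤ 2^h≤448t 2^h≤448t ⟩
    (448 * t) * (448 * t)      ≡⟨ scaled-product 448 448 t t ⟩
    448 * 448 * (t * t)        ∎
    where open ℕ.≤-Reasoning

  rounds≤ : 1 + length (treeShape k (suc (h + h)) (h + h)) ≤ 37 * ℓ
  rounds≤ = begin
    1 + length (treeShape k (suc (h + h)) (h + h)) ≡⟨ cong suc (length-treeShape k (suc (h + h)) (h + h)) ⟩
    1 + 2 * (h + h)                                ≤⟨ ℕ.+-mono-≤ (s≤s z≤n) (ℕ.*-monoʳ-≤ 2 (ℕ.+-mono-≤ h≤9ℓ h≤9ℓ)) ⟩
    ℓ + 2 * (9 * ℓ + 9 * ℓ)                        ≡⟨ eq ℓ ⟩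
    37 * ℓ                                         ∎
    where
    open ℕ.≤-Reasoning
    eq : ∀ ℓ → ℓ + 2 * (9 * ℓ + 9 * ℓ) ≡ 37 * ℓ
    eq = ℕ-Ring.solve-∀

  -- The tree determines the power of the logarithm: O(t) paths, O(ℓ) levels, and O(ℓ) bits per path
  -- and level. The seed adds only O(ℓ t) and the logarithm of `n`.
  communication≤ : ∀ n .{{_ : NonZero n}} X → ℓ * ℓ * t ≤ X →
    3 * clog (suc (period n h)) + suc (h + h) + sum (map (uncurry _+_) (treeShape k (suc (h + h)) (h + h))) ≤
    37321 * X + 3 * ⌈log₂ n ⌉
  communication≤ n X ℓℓt≤X = begin
    3 * clog (suc (period n h)) + suc d + sum (map (uncurry _+_) (treeShape k (suc d) d))
      ≡⟨ cong (3 * clog (suc (period n h)) + suc d +_) (communication-treeShape k (suc d) d) ⟩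
    3 * clog (suc (period n h)) + suc d + d * (k * suc d + k)
      ≤⟨ ℕ.+-mono-≤ (ℕ.+-mono-≤ (ℕ.*-monoʳ-≤ 3 (ℕ.≤-trans (clog-period n h) (ℕ.+-mono-≤ 2≤2X (ℕ.+-monoˡ-≤ ⌈log₂ n ⌉ h2^h≤)))) 1+d≤) tree≤ ⟩
    3 * (2 * X + (9 * 448 * X + ⌈log₂ n ⌉)) + 19 * X + 18 * (70 * 20) * X
      ≡⟨ collect 2 (9 * 448) 19 (18 * (70 * 20)) X ⌈log₂ n ⌉ ⟩
    (3 * (2 + 9 * 448) + 19 + 18 * (70 * 20)) * X + 3 * ⌈log₂ n ⌉ ∎
    where
    open ℕ.≤-Reasoning
    d = h + h
    collect : ∀ a b c e X n → 3 * (a * X + (b * X + n)) + c * X + e * X ≡ (3 * (a + b) + c + e) * X + 3 * n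
    collect = ℕ-Ring.solve-∀
    ℓt≤X : ℓ * t ≤ X
    ℓt≤X = ℕ.≤-trans (ℕ.*-monoˡ-≤ t (ℕ.m≤m*n ℓ ℓ)) ℓℓt≤X
    ℓ≤X : ℓ ≤ X
    ℓ≤X = ℕ.≤-trans (ℕ.m≤m*n ℓ t) ℓt≤X
    2≤2X : 2 ≤ 2 * X
    2≤2X = ℕ.*-monoʳ-≤ 2 (ℕ.≤-trans (s≤s z≤n) ℓ≤X)
    h2^h≤ : h * 2 ^ h ≤ 9 * 448 * X
    h2^h≤ = ℕ.≤-trans (ℕ.*-mono-≤ h≤9ℓ 2^h≤448t) (ℕ.≤-trans (ℕ.≤-reflexive (scaled-product 9 448 ℓ t)) (ℕ.*-monoʳ-≤ (9 * 448) ℓt≤X))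
    d≤18ℓ : d ≤ 18 * ℓ
    d≤18ℓ = ℕ.≤-trans (ℕ.+-mono-≤ h≤9ℓ h≤9ℓ) (ℕ.≤-reflexive (sym (ℕ.*-distribʳ-+ ℓ 9 9)))
    1+d≤19ℓ : suc d ≤ 19 * ℓ
    1+d≤19ℓ = ℕ.+-mono-≤ (s≤s (z≤n {⌈log₂ t ⌉})) d≤18ℓ
    1+d≤ : suc d ≤ 19 * X
    1+d≤ = ℕ.≤-trans 1+d≤19ℓ (ℕ.*-monoʳ-≤ 19 ℓ≤X)
    factor : ∀ k d → k * suc d + k ≡ k * (1 + suc d)
    factor = ℕ-Ring.solve-∀
    rearrange : ∀ a b c ℓ t → (a * ℓ) * ((b * t) * (c * ℓ)) ≡ a * (b * c) * (ℓ * ℓ * t)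
    rearrange = ℕ-Ring.solve-∀
    tree≤ : d * (k * suc d + k) ≤ 18 * (70 * 20) * X
    tree≤ = begin
      d * (k * suc d + k)                  ≡⟨ cong (d *_) (factor k d) ⟩
      d * (k * (1 + suc d))                ≤⟨ ℕ.*-mono-≤ d≤18ℓ (ℕ.*-mono-≤ k≤70t (ℕ.+-mono-≤ (s≤s (z≤n {⌈log₂ t ⌉})) 1+d≤19ℓ)) ⟩
      (18 * ℓ) * ((70 * t) * (20 * ℓ))     ≡⟨ rearrange 18 70 20 ℓ t ⟩
      18 * (70 * 20) * (ℓ * ℓ * t)         ≤⟨ ℕ.*-monoʳ-≤ (18 * (70 * 20)) ℓℓt≤X ⟩
      18 * (70 * 20) * X                   ∎

-- The protocol for given parameters, and its asymptotics

module Instance {p : Params} (th : Thresholds p) where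
  open Params p
  open Thresholds th

  k h : ℕ
  k = 10 * suc D-1
  -- Gives `32 D ≤ 2 ^ h ≤ 64 D`: the lower bound controls the variance, the upper one keeps the
  -- sample at O(D²) points.
  h = 5 + clog (suc D-1)

  module Π (n : ℕ) = Protocol k h cut (1/suc (7 + 8 * D-1)) (clog (suc (period n h)))

  protocol : IPP εc εf
  protocol = record
    { shape    = λ n → Π.shape n
    ; verifier = λ n σ → Π.verifier n n σ
    ; honest   = λ n σ → Π.honest n n σ
    ; complete = λ n x σ close → Π.Correct.completeness n n σ D-1 refl refl (32*m≤2^[5+clog] (suc D-1))
                   (m≤2^clog (suc (period n h))) x (below (deviation x σ) close)
    ; sound    = λ n x σ far → Π.Correct.soundness n n σ D-1 refl refl (32*m≤2^[5+clog] (suc D-1))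
                   (m≤2^clog (suc (period n h))) x (above (deviation x σ) far)
    }

  module Bounds (t : ℕ) .{{_ : NonZero t}} (1/g≤t : gap ⁻¹≤ t) where
    k≤70t : k ≤ 70 * t
    k≤70t = subst (k ≤_) (sym (ℕ.*-assoc 10 7 t)) (ℕ.*-monoʳ-≤ 10 (bound t 1/g≤t))

    open Costs k h t k≤70t (5+clog≤9* (suc D-1) t (bound t 1/g≤t)) (2^[5+clog]≤448* D-1 t (bound t 1/g≤t)) public

  verifierQueries≤ : ∀ n .{{_ : NonZero n}} c B → c * k ≤ B → IPP.VerifierQueries protocol n c B
  verifierQueries≤ n c B ck≤B x σ P = ℕ.≤-trans (ℕ.*-monoʳ-≤ c (Π.queryCost-verifier n n σ x P)) ck≤B

  honestQueries≤ : ∀ n .{{_ : NonZero n}} c B → c * (2 ^ (h + h) + 0) ≤ B → IPP.HonestQueries protocol n c B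
  honestQueries≤ n c B ≤B x σ _ = ℕ.≤-trans (ℕ.*-monoʳ-≤ c (Π.queryCost-honest n n σ x)) ≤B

module _ (C : ℕ) (40000≤C : 40000 ≤ C) (448²≤C : 448 * 448 ≤ C) where

  private
    ≤C : ∀ m → m ≤ 40000 → ∀ y z → y ≤ z → m * y ≤ C * z
    ≤C m m≤ y z y≤z = ℕ.*-mono-≤ (ℕ.≤-trans m≤ 40000≤C) y≤z

  -- Both query counts are at most `C * (t * t)`, the verifier's O(t) included, so applying the
  -- regime with the factor `c * C` settles both at once.
  sublinearAt : ∀ {p} (th : Thresholds p) t → Params.gap p ⁻¹≤ t → ∀ n .{{_ : NonZero n}} c → c * C * (t * t) ≤ n →
    IPP.VerifierQueries (Instance.protocol th) n c n × IPP.HonestQueries (Instance.protocol th) n c n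
  sublinearAt th t@(suc _) 1/g≤t n c cCt²≤n =
      verifierQueries≤ n c n (finish k (ℕ.≤-trans k≤70t (≤C 70 (from-yes (70 ≤? 40000)) t (t * t) (ℕ.m≤m*n t t))))
    , honestQueries≤ n c n (finish (2 ^ (h + h) + 0) (ℕ.≤-trans honest≤ (ℕ.*-monoˡ-≤ (t * t) 448²≤C)))
    where
    open Instance th
    open Bounds t 1/g≤t
    finish : ∀ q → q ≤ C * (t * t) → c * q ≤ n
    finish q q≤ = ℕ.≤-trans (ℕ.*-monoʳ-≤ c q≤) (ℕ.≤-trans (ℕ.≤-reflexive (sym (ℕ.*-assoc c C (t * t)))) cCt²≤n)

  sublinear : DoublySublinear (λ p → Instance.protocol (thresholds p))
  sublinear p regime c = proj₁ (regime (c * C)) , λ n N≤n → let (t , 1/g≤t , cCt²≤n) = proj₂ (regime (c * C)) n N≤n in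
    sublinearAt (thresholds (p n)) t 1/g≤t n c cCt²≤n

  complexityAt : ∀ {p} (th : Thresholds p) n .{{_ : NonZero n}} t → Params.gap p ⁻¹≤ t →
    (IPP.rounds (Instance.protocol th) n ≤ C * (1 + ⌈log₂ t ⌉)) ×
    IPP.VerifierQueries (Instance.protocol th) n 1 (C * ((1 + ⌈log₂ (t * t) ⌉) ^ 2 * t)) ×
    IPP.HonestQueries (Instance.protocol th) n 1 (C * (t * t)) ×
    (IPP.communication (Instance.protocol th) n ≤ C * ((1 + ⌈log₂ (t * t) ⌉) ^ 2 * t + ⌈log₂ n ⌉))
  complexityAt th n t@(suc _) 1/g≤t =
      ℕ.≤-trans rounds≤ (≤C 37 (from-yes (37 ≤? 40000)) ℓ ℓ ℕ.≤-refl)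
    , verifierQueries≤ n 1 (C * X) (once k (ℕ.≤-trans k≤70t (≤C 70 (from-yes (70 ≤? 40000)) t X (ℕ.m≤n*m t (Λ ^ 2) {{ℕ.m^n≢0 Λ 2}}))))
    , honestQueries≤ n 1 (C * (t * t)) (once (2 ^ (h + h) + 0) (ℕ.≤-trans honest≤ (ℕ.*-monoˡ-≤ (t * t) 448²≤C)))
    , ℕ.≤-trans (communication≤ n X ℓℓt≤X)
        (ℕ.≤-trans (ℕ.+-mono-≤ (≤C 37321 (from-yes (37321 ≤? 40000)) X X ℕ.≤-refl)
                               (≤C 3 (from-yes (3 ≤? 40000)) ⌈log₂ n ⌉ ⌈log₂ n ⌉ ℕ.≤-refl))
          (ℕ.≤-reflexive (sym (ℕ.*-distribˡ-+ C X ⌈log₂ n ⌉))))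
    where
    open Instance th
    open Bounds t 1/g≤t
    Λ = 1 + ⌈log₂ (t * t) ⌉
    X = Λ ^ 2 * t
    once : ∀ q {b} → q ≤ b → 1 * q ≤ b
    once q {b} = subst (_≤ b) (sym (ℕ.*-identityˡ q))
    ℓ≤Λ : ℓ ≤ Λ
    ℓ≤Λ = s≤s (⌈log₂⌉-mono-≤ (ℕ.m≤m*n t t))
    ℓℓt≤X : ℓ * ℓ * t ≤ X
    ℓℓt≤X = ℕ.*-monoˡ-≤ t (subst (ℓ * ℓ ≤_) (cong (Λ *_) (sym (ℕ.*-identityʳ Λ))) (ℕ.*-mono-≤ ℓ≤Λ ℓ≤Λ))

corollary3p2 : Σ Family λ Π →
    DoublySublinear Π ×
    (∃[ C ] ∃[ k ] ∀ (p : Params) (n : ℕ) .{{_ : NonZero n}} (t : ℕ) →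
    Params.gap p ⁻¹≤ t →
    (IPP.rounds (Π p) n ≤ C * (1 + ⌈log₂ t ⌉)) ×
    IPP.VerifierQueries (Π p) n 1 (C * ((1 + ⌈log₂ (t * t) ⌉) ^ k * t)) ×
    IPP.HonestQueries (Π p) n 1 (C * (t * t)) ×
    (IPP.communication (Π p) n ≤ C * ((1 + ⌈log₂ (t * t) ⌉) ^ k * t + ⌈log₂ n ⌉)))
corollary3p2 = (λ p → Instance.protocol (thresholds p)) , sublinear C 40000≤C 448²≤C , C , 2 , λ p n t → complexityAt C 40000≤C 448²≤C (thresholds p) n t
  where
  -- The honest prover's 4^h queries, with `2 ^ h ≤ 448 * t`, need this constant. The largest of the
  -- others is 37321, from the communication.
  C = 448 * 448
  40000≤C : 40000 ≤ C
  40000≤C = from-yes (40000 ≤? C)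
  448²≤C : 448 * 448 ≤ C
  448²≤C = ℕ.≤-refl
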